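{- Let $\varepsilon$ be a constant with $0<\varepsilon<1/4$. If there is a polynomial-time $O(m^{\varepsilon})$-approximation algorithm for the rank reduction problem on transversal matroids with $m$ elements, then there is a polynomial-time $O(n^{4\varepsilon})$-approximation algorithm for the densest $k$-subgraph problem on graphs with $n$ vertices.
   Context: All graphs are finite, undirected and simple; for a graph $H$, $|H|$ denotes its number of vertices and $||H||$ its number of edges. A transversal matroid is given by a bipartite graph $G$ with bipartition $(A,B)$ (its model): the ground set is $A$, and $X\subseteq A$ is independent iff some matching of $G$ covers $X$; the rank of $X\subseteq A$ is $r(X)=$ the maximum size of a matching in $G[X\cup B]$. The number of elements is $m=|A|$. The rank reduction problem: given a matroid on ground set $A$ with rank function $r$ (here given by its model) and a positive integer $k$, find a minimum-size $X\subseteq A$ with $r(A\setminus X)\le r(A)-k$; an $\alpha$-approximation algorithm returns a feasible $X$ of size at most $\alpha$ times the optimum. The densest $k$-subgraph problem: given a graph $G$ and a positive integer $k\le |G|$, find a subgraph $H$ of $G$ with $|H|=k$ and $||H||$ maximum; an $\alpha$-approximation algorithm returns a subgraph $H$ with $|H|=k$ and $||H||$ at least the optimum divided by $\alpha$. An $O(f)$-approximation algorithm is an $\alpha$-approximation algorithm with $\alpha\le c f$ for some absolute constant $c>0$. -}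

module Defs where

open import Data.Bool.Base using (Bool; true; false; T)
open import Data.Bool.Properties using (T?)
open import Data.Fin.Base using (Fin)
import Data.Fin.Properties as Fin
open import Data.Fin.Subset using (Subset; _∈_; ∣_∣; ∁; ⊤)
open import Data.Fin.Subset.Properties using (_∈?_)
open import Data.Integer.Base using (+_)
open import Data.List.Base as List
  using (List; []; _∷_; _++_; map; length; filter; cartesianProduct; allFin)
open import Data.List.Extrema.Nat using (max)
open import Data.List.Relation.Unary.AllPairs using (AllPairs; allPairs?)
open import Data.Nat.Base as ℕ using (ℕ; zero; suc)
open import Data.Product.Base using (Σ; ∃; ∃-syntax; _×_; _,_; proj₁; proj₂)
open import Data.Rational.Base using (ℚ; _<_; _/_; _*_; 1/_; Positive)
import Data.Rational.Properties as ℚ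
open import Data.Sum.Base using (_⊎_)
open import Data.Vec.Base as Vec using (tabulate)
open import Relation.Binary.PropositionalEquality
  using (_≡_; _≢_; refl; sym; trans; cong; subst)
open import Relation.Nullary.Decidable using (Dec; ¬?; _×-dec_)
open import Relation.Nullary.Negation using (¬_)

------------------------------------------------------------------------
-- Real numbers (Dedekind cuts)

record ℝ : Set₁ where
  field
    Lower Upper     : ℚ → Set
    lower-inhabited : ∃ Lower
    upper-inhabited : ∃ Upper
    lower-closed    : ∀ {q r} → q < r → Lower r → Lower q
    upper-closed    : ∀ {q r} → q < r → Upper q → Upper r
    lower-open      : ∀ {q} → Lower q → ∃[ r ] (q < r × Lower r)
    upper-open      : ∀ {r} → Upper r → ∃[ q ] (q < r × Upper q)
    disjoint        : ∀ {q} → ¬ (Lower q × Upper q)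
    located         : ∀ {q r} → q < r → Lower q ⊎ Upper r

_ℚ<_ : ℚ → ℝ → Set
q ℚ< x = ℝ.Lower x q

_<ℚ_ : ℝ → ℚ → Set
x <ℚ q = ℝ.Upper x q

infix 4 _ℚ<_ _<ℚ_

module _ (c : ℚ) .{{c>0 : Positive c}} where
  private
    instance
      c≢0 = ℚ.pos⇒nonZero c
      c⁻¹>0 : Positive (1/ c)
      c⁻¹>0 = ℚ.1/pos⇒pos c

    *c*c⁻¹ : ∀ q → q * c * 1/ c ≡ q
    *c*c⁻¹ q = trans (ℚ.*-assoc q c (1/ c))
      (trans (cong (q *_) (ℚ.*-inverseʳ c)) (ℚ.*-identityʳ q))

    *c⁻¹*c : ∀ q → q * 1/ c * c ≡ q
    *c⁻¹*c q = trans (ℚ.*-assoc q (1/ c) c)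
      (trans (cong (q *_) (ℚ.*-inverseˡ c)) (ℚ.*-identityʳ q))

  scale : ℝ → ℝ
  scale x = record
    { Lower           = λ q → Lower (q * 1/ c)
    ; Upper           = λ q → Upper (q * 1/ c)
    ; lower-inhabited = proj₁ lower-inhabited * c
                      , subst Lower (sym (*c*c⁻¹ _)) (proj₂ lower-inhabited)
    ; upper-inhabited = proj₁ upper-inhabited * c
                      , subst Upper (sym (*c*c⁻¹ _)) (proj₂ upper-inhabited)
    ; lower-closed    = λ q<r → lower-closed (ℚ.*-monoˡ-<-pos (1/ c) q<r)
    ; upper-closed    = λ q<r → upper-closed (ℚ.*-monoˡ-<-pos (1/ c) q<r)
    ; lower-open      = λ {q} l → let r , q<r , l′ = lower-open l in
        r * c
        , subst (_< r * c) (*c⁻¹*c q) (ℚ.*-monoˡ-<-pos c q<r)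
        , subst Lower (sym (*c*c⁻¹ r)) l′
    ; upper-open      = λ {r} u → let q , q<r , u′ = upper-open u in
        q * c
        , subst (q * c <_) (*c⁻¹*c r) (ℚ.*-monoˡ-<-pos c q<r)
        , subst Upper (sym (*c*c⁻¹ q)) u′
    ; disjoint        = disjoint
    ; located         = λ q<r → located (ℚ.*-monoˡ-<-pos (1/ c) q<r)
    }
    where open ℝ x

-- The inequality  x ≤ c · n^ε · y  for a real exponent ε > 0.  Since n^ε is
-- the infimum of n^(p/q) over the rationals p/q > ε (for n = 0 both are 0),
-- it holds iff  x ≤ c · n^(p/q) · y  for all of these; take q-th powers.

_≤_·_^[_]·_ : ℕ → ℕ → ℕ → ℝ → ℕ → Set
x ≤ c · n ^[ ε ]· y = ∀ p q .{{_ : ℕ.NonZero q}} → ε <ℚ (+ p / q) →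
  x ℕ.^ q ℕ.≤ (c ℕ.* y) ℕ.^ q ℕ.* n ℕ.^ p

------------------------------------------------------------------------
-- Polynomial-time computation
--
-- The machine model is the WHILE language on binary trees (N. D. Jones,
-- "Computability and Complexity"), in combinator form: a program transforms
-- a single tree, and several variables are held as components of that tree.
-- Every operation has unit cost.  As trees are immutable, `pair`, `hd` and
-- `tl` only copy pointers, so a run of t steps is simulated with polynomial
-- overhead by a RAM or Turing machine working on trees with shared subtrees,
-- and conversely.  Below, correct outputs have size polynomial in that of the
-- input, so unfolding the sharing in the output is also polynomial.

data Tree : Set where
  leaf : Tree
  node : Tree → Tree → Tree

head tail : Tree → Tree
head leaf       = leaf
head (node x _) = x
tail leaf       = leaf
tail (node _ y) = y

size : Tree → ℕ
size leaf       = 1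
size (node x y) = suc (size x ℕ.+ size y)

data Program : Set where
  idp nil hd tl : Program
  _⨾_           : Program → Program → Program
  pair          : Program → Program → Program
  if_then_else_ : Program → Program → Program → Program
  while_loop_   : Program → Program → Program

-- Run P x y t: on input x, the program P halts with output y after t steps.
-- As a truth value, leaf is false and every other tree is true.

data Run : Program → Tree → Tree → ℕ → Set where
  run-idp  : ∀ {x} → Run idp x x 1
  run-nil  : ∀ {x} → Run nil x leaf 1
  run-hd   : ∀ {x} → Run hd x (head x) 1
  run-tl   : ∀ {x} → Run tl x (tail x) 1
  run-⨾    : ∀ {P Q x y z s t} → Run P x y s → Run Q y z t →
             Run (P ⨾ Q) x z (suc (s ℕ.+ t))
  run-pair : ∀ {P Q x y z s t} → Run P x y s → Run Q x z t →
             Run (pair P Q) x (node y z) (suc (s ℕ.+ t))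
  run-then : ∀ {B P Q x b y s t} → Run B x b s → b ≢ leaf → Run P x y t →
             Run (if B then P else Q) x y (suc (s ℕ.+ t))
  run-else : ∀ {B P Q x y s t} → Run B x leaf s → Run Q x y t →
             Run (if B then P else Q) x y (suc (s ℕ.+ t))
  run-stop : ∀ {B P x s} → Run B x leaf s →
             Run (while B loop P) x x (suc s)
  run-loop : ∀ {B P x b y z s t u} → Run B x b s → b ≢ leaf → Run P x y t →
             Run (while B loop P) y z u →
             Run (while B loop P) x z (suc (s ℕ.+ t ℕ.+ u))

-- Some program halts on every instance in time polynomial in the size of the
-- encoded instance, with an output that is correct for that instance.

PolyTime : {Instance : Set} → (Instance → Tree) →
           (Instance → Tree → Set) → Set
PolyTime {Instance} encode Correct =
  ∃[ P ] ∃[ a ] ∃[ d ] ((i : Instance) →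
    ∃[ y ] ∃[ t ] ( Run P (encode i) y t
                  × t ℕ.≤ a ℕ.* size (encode i) ℕ.^ d ℕ.+ a
                  × Correct i y))

encodeBool : Bool → Tree
encodeBool false = leaf
encodeBool true  = node leaf leaf

encodeList : List Tree → Tree
encodeList = List.foldr node leaf

-- Unary; used only for the parameter k.  In a feasible instance k is at most
-- the number of elements or vertices, so a binary encoding would give the
-- same notion of polynomial time.

encodeℕ : ℕ → Tree
encodeℕ n = encodeList (List.replicate n leaf)

encodeSubset : ∀ {n} → Subset n → Tree
encodeSubset X = encodeList (map encodeBool (Vec.toList X))

encodeMatrix : ∀ {m n} → (Fin m → Fin n → Bool) → Tree
encodeMatrix M =
  encodeList (Vec.toList (tabulate λ i → encodeSubset (tabulate (M i))))

------------------------------------------------------------------------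
-- Optimal values

IsMinimum IsMaximum : (ℕ → Set) → ℕ → Set
IsMinimum P v = P v × (∀ w → P w → v ℕ.≤ w)
IsMaximum P v = P v × (∀ w → P w → w ℕ.≤ v)

------------------------------------------------------------------------
-- Transversal matroids and rank reduction

record BipartiteGraph : Set where
  field
    a b : ℕ
    adj : Fin a → Fin b → Bool

sublists : ∀ {A : Set} → List A → List (List A)
sublists []       = [] ∷ []
sublists (x ∷ xs) = map (x ∷_) (sublists xs) ++ sublists xs

module _ (G : BipartiteGraph) where
  open BipartiteGraph G

  Edge : Set
  Edge = Fin a × Fin b

  -- The edges of G[X ∪ B].
  edgesAt : Subset a → List Edge
  edgesAt X = filter (λ (i , j) → (i ∈? X) ×-dec T? (adj i j))
                     (cartesianProduct (allFin a) (allFin b))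

  Disjoint : Edge → Edge → Set
  Disjoint (i , j) (i′ , j′) = i ≢ i′ × j ≢ j′

  disjoint? : ∀ e f → Dec (Disjoint e f)
  disjoint? (i , j) (i′ , j′) = ¬? (i Fin.≟ i′) ×-dec ¬? (j Fin.≟ j′)

  matchings : Subset a → List (List Edge)
  matchings X = filter (allPairs? disjoint?) (sublists (edgesAt X))

  rank : Subset a → ℕ
  rank X = max 0 (map length (matchings X))

record RankReduction : Set where
  field
    model : BipartiteGraph
    k     : ℕ
    k>0   : 0 ℕ.< k
  open BipartiteGraph model public

  -- r(A \ X) ≤ r(A) - k, without truncated subtraction.
  Feasible : Subset a → Set
  Feasible X = rank model (∁ X) ℕ.+ k ℕ.≤ rank model ⊤

  IsOptimum : ℕ → Set
  IsOptimum = IsMinimum λ s → ∃[ X ] (Feasible X × ∣ X ∣ ≡ s)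

  encode : Tree
  encode = node (encodeMatrix adj) (encodeℕ k)

-- The constant c of the O-notation may be taken to be a natural number, as
-- increasing it only weakens the bound.  The output is unconstrained when the
-- instance has no feasible solution, as there is then no optimum.

RankReductionApproximable : ℝ → Set
RankReductionApproximable ε = ∃[ c ] (0 ℕ.< c ×
  PolyTime RankReduction.encode λ I y → let open RankReduction I in
    ∀ opt → IsOptimum opt →
    ∃[ X ] ( y ≡ encodeSubset X
           × Feasible X
           × ∣ X ∣ ≤ c · a ^[ ε ]· opt))

------------------------------------------------------------------------
-- Densest k-subgraph

edgeCount : ∀ {n} → (Fin n → Fin n → Bool) → ℕ
edgeCount {n} adj =
  length (filter (λ (i , j) → (i Fin.<? j) ×-dec T? (adj i j))
                 (cartesianProduct (allFin n) (allFin n)))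

record Graph (n : ℕ) : Set where
  field
    adj    : Fin n → Fin n → Bool
    symm   : ∀ {i j} → T (adj i j) → T (adj j i)
    irrefl : ∀ {i} → ¬ T (adj i i)

record Subgraph {n} (G : Graph n) : Set where
  field
    vertices : Subset n
    adj      : Fin n → Fin n → Bool
    symm     : ∀ {i j} → T (adj i j) → T (adj j i)
    ends     : ∀ {i j} → T (adj i j) → i ∈ vertices × j ∈ vertices
    edges⊆   : ∀ {i j} → T (adj i j) → T (Graph.adj G i j)

∣_∣ᵥ ∣∣_∣∣ : ∀ {n} {G : Graph n} → Subgraph G → ℕ
∣ H ∣ᵥ   = ∣ Subgraph.vertices H ∣
∣∣ H ∣∣ = edgeCount (Subgraph.adj H)

encodeSubgraph : ∀ {n} {G : Graph n} → Subgraph G → Tree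
encodeSubgraph H =
  node (encodeSubset (Subgraph.vertices H)) (encodeMatrix (Subgraph.adj H))

record DensestSubgraph : Set where
  field
    n     : ℕ
    graph : Graph n
    k     : ℕ
    k>0   : 0 ℕ.< k
    k≤n   : k ℕ.≤ n

  IsOptimum : ℕ → Set
  IsOptimum = IsMaximum λ s →
    Σ (Subgraph graph) λ H → ∣ H ∣ᵥ ≡ k × ∣∣ H ∣∣ ≡ s

  encode : Tree
  encode = node (encodeMatrix (Graph.adj graph)) (encodeℕ k)

DensestSubgraphApproximable : ℝ → Set
DensestSubgraphApproximable ε = ∃[ c ] (0 ℕ.< c ×
  PolyTime DensestSubgraph.encode λ I y → let open DensestSubgraph I in
    ∀ opt → IsOptimum opt →
    Σ (Subgraph graph) λ H →
      y ≡ encodeSubgraph H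
      × ∣ H ∣ᵥ ≡ k
      × opt ≤ c · n ^[ ε ]· ∣∣ H ∣∣)

{-# OPTIONS --safe #-}
module Submission where

-- Given a graph on n vertices, take 2n copies of every vertex on one side of a
-- bipartite graph and the edges on the other, each edge being adjacent to all
-- copies of its two ends.  If W induces at least p edges, deleting all copies
-- of W reduces the rank by at least p.  Conversely, let deleting X reduce the
-- rank by p, and let U be the set of vertices with at least n copies in X.  Every edge
-- not inside U can be matched to one of the n or more remaining copies of an
-- end outside U, so U induces at least p edges, and n |U| ≤ |X|.
--
-- With p the optimum of the densest k-subgraph instance, an approximation of
-- ratio α = O((2n²)^ε) thus yields a set U of at most 2αk vertices inducing at
-- least p edges.  Cut U into O(α) blocks of size ⌊k/2⌋: some union of two
-- blocks induces an Ω(1/α²) fraction of these edges, and α² = O(n^(4ε)).  The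
-- algorithm tries all p and all pairs of blocks, and keeps the best candidate.

open import Defs hiding (if_then_else_)
open import Data.Bool.Base using (Bool; true; false; not; _∧_; _∨_; if_then_else_; T)
open import Data.Bool.Properties using (T?; T-∧; T-∨; T-not-≡; T-≡)
open import Data.Empty using (⊥-elim)
open import Data.Fin.Base as Fin using (Fin; toℕ; fromℕ<; remQuot; combine; _↑ˡ_)
import Data.Fin.Properties as Fin
open import Data.Fin.Subset as Subset using (Subset; ∣_∣; ∁; ⊤)
open import Data.Fin.Subset.Properties using (anySubset?)
import Data.Integer.Base as ℤ
import Data.Integer.Properties as ℤ
open import Data.List.Base as List
  using (List; []; _∷_; _++_; map; length; concatMap; drop; take; replicate; reverse;
         foldl; foldr; allFin; upTo; cartesianProduct; filter; filterᵇ)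
import Data.List.Properties as List
open import Data.List.Extrema.Nat using (max≤v⁺; v≤max⁺)
open import Data.List.Membership.Propositional using (_∈_; find)
open import Data.List.Membership.Propositional.Properties
open import Data.List.Relation.Unary.All as All using (All; []; _∷_)
open import Data.List.Relation.Unary.AllPairs as AllPairs using (AllPairs; []; _∷_; allPairs?)
import Data.List.Relation.Unary.AllPairs.Properties as AllPairs
open import Data.List.Relation.Unary.Any as Any using (here; there)
open import Data.List.Relation.Unary.Unique.Propositional using (Unique)
import Data.List.Relation.Unary.Unique.Propositional.Properties as Unique
open import Data.Nat.Base as ℕ hiding (_/_)
open import Data.Nat.DivMod using (m≡m%n+[m/n]*n; m%n<n; m/n*n≤m)
open import Data.Nat.Properties
open import Data.Nat.Solver using (module +-*-Solver)
open import Data.Product.Base as Product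
  using (Σ; ∃; ∃₂; ∃-syntax; Σ-syntax; _×_; _,_; proj₁; proj₂; uncurry)
open import Data.Rational.Base as ℚ using (0ℚ)
import Data.Rational.Properties as ℚ
import Data.Rational.Unnormalised.Base as ℚᵘ
import Data.Rational.Unnormalised.Properties as ℚᵘ
open import Data.Sum.Base using (_⊎_; inj₁; inj₂; [_,_]′)
open import Data.Unit.Base as Unit using (tt)
open import Data.Vec.Base as Vec using (lookup)
import Data.Vec.Properties as Vec
open import Function.Base using (_∘_; id; flip; const)
open import Function.Bundles using (module Equivalence)
open import Relation.Binary.PropositionalEquality hiding ([_])
open import Relation.Nullary using (does; yes; no; ¬_; contradiction)
open import Relation.Nullary.Decidable using (_×-dec_)
open import Relation.Unary using (Decidable)
open Equivalence using (to; from)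


-- Polynomial-time programs

-- Copies turn a matching question into counting. With one element per vertex, edges would compete
-- for it and the rank could not exceed the number of vertices. With `n` surviving copies of a
-- vertex, the copy for an edge can be indexed by its other end, and no Hall-type argument is
-- needed. The number `2n` is chosen so that fewer than `n` deleted copies leave at least `n`. An
-- optimal `W` costs `2n` per vertex while each heavy vertex accounts for `n` deletions, so the
-- copies cost only a factor 2 in the ratio. The given algorithm promises nothing on infeasible
-- queries; hence `p` runs from 1 to the number of edges, where deleting everything is feasible.
-- Each function of the algorithm occurs twice: as an Agda function, about which the combinatorics
-- is proved, and under a primed name as a proof that a single program computes it in polynomial
-- time. Output size is tracked along with time, since pairing shares subtrees at unit cost: a fast
-- program can build an exponentially large tree, and a loop over that tree would not be polynomial.

infixl 6 _⊕_
infixl 7 _⊗_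
infixr 9 _∘ᵖ_

-- Syntax instead of functions: bounds of composed programs need substitution, and monotonicity and
-- the monomial bound then follow by induction.
data Polynomial : Set where
  var     : Polynomial
  lit     : ℕ → Polynomial
  _⊕_ _⊗_ : Polynomial → Polynomial → Polynomial

eval : Polynomial → ℕ → ℕ
eval var     n = n
eval (lit c) n = c
eval (p ⊕ q) n = eval p n + eval q n
eval (p ⊗ q) n = eval p n * eval q n

eval-mono : ∀ p {m n} → m ≤ n → eval p m ≤ eval p n
eval-mono var     m≤n = m≤n
eval-mono (lit c) m≤n = ≤-refl
eval-mono (p ⊕ q) m≤n = +-mono-≤ (eval-mono p m≤n) (eval-mono q m≤n)
eval-mono (p ⊗ q) m≤n = *-mono-≤ (eval-mono p m≤n) (eval-mono q m≤n)

_∘ᵖ_ : Polynomial → Polynomial → Polynomial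
var     ∘ᵖ r = r
lit c   ∘ᵖ r = lit c
(p ⊕ q) ∘ᵖ r = (p ∘ᵖ r) ⊕ (q ∘ᵖ r)
(p ⊗ q) ∘ᵖ r = (p ∘ᵖ r) ⊗ (q ∘ᵖ r)

eval-∘ᵖ : ∀ p r n → eval (p ∘ᵖ r) n ≡ eval p (eval r n)
eval-∘ᵖ var     r n = refl
eval-∘ᵖ (lit c) r n = refl
eval-∘ᵖ (p ⊕ q) r n = cong₂ _+_ (eval-∘ᵖ p r n) (eval-∘ᵖ q r n)
eval-∘ᵖ (p ⊗ q) r n = cong₂ _*_ (eval-∘ᵖ p r n) (eval-∘ᵖ q r n)

≤-eval-∘ᵖ : ∀ p r {m n} → m ≤ eval r n → eval p m ≤ eval (p ∘ᵖ r) n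
≤-eval-∘ᵖ p r m≤ = ≤-trans (eval-mono p m≤) (≤-reflexive (sym (eval-∘ᵖ p r _)))

power : ℕ → Polynomial
power zero    = lit 1
power (suc d) = var ⊗ power d

eval-power : ∀ d n → eval (power d) n ≡ n ^ d
eval-power zero    n = refl
eval-power (suc d) n = cong (n *_) (eval-power d n)

-- Brings a bound into the shape required by `PolyTime`. Degrees are added in both the sum and the
-- product case. At 0 a monomial of positive degree would vanish; sizes of trees are positive.
eval≤monomial : ∀ p → ∃₂ λ a d → ∀ n .{{_ : NonZero n}} → eval p n ≤ a * n ^ d
eval≤monomial var     = 1 , 1 , λ n → ≤-reflexive (sym (trans (*-identityˡ (n ^ 1)) (^-identityʳ n)))
eval≤monomial (lit c) = c , 0 , λ n → ≤-reflexive (sym (*-identityʳ c))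
eval≤monomial (p ⊕ q) with eval≤monomial p | eval≤monomial q
... | a , d , p≤ | b , e , q≤ = a + b , d + e , λ n → begin
  eval p n + eval q n              ≤⟨ +-mono-≤ (p≤ n) (q≤ n) ⟩
  a * n ^ d + b * n ^ e            ≤⟨ +-mono-≤ (*-monoʳ-≤ a (^-monoʳ-≤ n (m≤m+n d e)))
                                               (*-monoʳ-≤ b (^-monoʳ-≤ n (m≤n+m e d))) ⟩
  a * n ^ (d + e) + b * n ^ (d + e) ≡⟨ *-distribʳ-+ (n ^ (d + e)) a b ⟨
  (a + b) * n ^ (d + e)            ∎
  where open ≤-Reasoning
eval≤monomial (p ⊗ q) with eval≤monomial p | eval≤monomial q
... | a , d , p≤ | b , e , q≤ = a * b , d + e , λ n → begin
  eval p n * eval q n         ≤⟨ *-mono-≤ (p≤ n) (q≤ n) ⟩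
  (a * n ^ d) * (b * n ^ e)   ≡⟨ [m*n]*[o*p]≡[m*o]*[n*p] a (n ^ d) b (n ^ e) ⟩
  (a * b) * (n ^ d * n ^ e)   ≡⟨ cong (a * b *_) (^-distribˡ-+-* n d e) ⟨
  (a * b) * n ^ (d + e)       ∎
  where open ≤-Reasoning

-- Combinators for programs with polynomial time and space bounds

1≤size : ∀ t → 1 ≤ size t
1≤size leaf       = ≤-refl
1≤size (node _ _) = s≤s z≤n

size-head : ∀ t → size (head t) ≤ size t
size-head leaf       = ≤-refl
size-head (node x y) = m≤n⇒m≤1+n (m≤m+n (size x) (size y))

size-tail : ∀ t → size (tail t) ≤ size t
size-tail leaf       = ≤-refl
size-tail (node x y) = m≤n⇒m≤1+n (m≤n+m (size y) (size x))

isNode : Tree → Bool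
isNode leaf       = false
isNode (node _ _) = true

infix 2 _⟶_

-- One program transforms Γ i into F i for every i, in time and space
-- polynomial in the size of Γ i.
record _⟶_ {I : Set} (Γ F : I → Tree) : Set where
  field
    program    : Program
    time space : Polynomial
    steps      : I → ℕ
    runs       : ∀ i → Run program (Γ i) (F i) (steps i)
    steps≤     : ∀ i → steps i ≤ eval time (size (Γ i))
    size≤      : ∀ i → size (F i) ≤ eval space (size (Γ i))

open _⟶_

module _ {I : Set} {Γ : I → Tree} where

  idᵗ : Γ ⟶ Γ
  idᵗ = record
    { program = idp ; time = lit 1 ; space = var ; steps = λ _ → 1
    ; runs = λ _ → run-idp ; steps≤ = λ _ → ≤-refl ; size≤ = λ _ → ≤-refl }

  leafᵗ : Γ ⟶ λ _ → leaf
  leafᵗ = record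
    { program = nil ; time = lit 1 ; space = lit 1 ; steps = λ _ → 1
    ; runs = λ _ → run-nil ; steps≤ = λ _ → ≤-refl ; size≤ = λ _ → ≤-refl }

  headᵗ : Γ ⟶ head ∘ Γ
  headᵗ = record
    { program = hd ; time = lit 1 ; space = var ; steps = λ _ → 1
    ; runs = λ _ → run-hd ; steps≤ = λ _ → ≤-refl ; size≤ = λ i → size-head (Γ i) }

  tailᵗ : Γ ⟶ tail ∘ Γ
  tailᵗ = record
    { program = tl ; time = lit 1 ; space = var ; steps = λ _ → 1
    ; runs = λ _ → run-tl ; steps≤ = λ _ → ≤-refl ; size≤ = λ i → size-tail (Γ i) }

  infixr 9 _⨾ᵗ_
  _⨾ᵗ_ : ∀ {F G} → Γ ⟶ F → F ⟶ G → Γ ⟶ G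
  P ⨾ᵗ Q = record
    { program = program P ⨾ program Q
    ; time    = lit 1 ⊕ (time P ⊕ (time Q ∘ᵖ space P))
    ; space   = space Q ∘ᵖ space P
    ; steps   = λ i → suc (steps P i + steps Q i)
    ; runs    = λ i → run-⨾ (runs P i) (runs Q i)
    ; steps≤  = λ i → s≤s (+-mono-≤ (steps≤ P i)
        (≤-trans (steps≤ Q i) (≤-eval-∘ᵖ (time Q) (space P) (size≤ P i))))
    ; size≤   = λ i →
        ≤-trans (size≤ Q i) (≤-eval-∘ᵖ (space Q) (space P) (size≤ P i))
    }

  nodeᵗ : ∀ {F G} → Γ ⟶ F → Γ ⟶ G → Γ ⟶ (λ i → node (F i) (G i))
  nodeᵗ P Q = record
    { program = pair (program P) (program Q)
    ; time    = lit 1 ⊕ (time P ⊕ time Q)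
    ; space   = lit 1 ⊕ (space P ⊕ space Q)
    ; steps   = λ i → suc (steps P i + steps Q i)
    ; runs    = λ i → run-pair (runs P i) (runs Q i)
    ; steps≤  = λ i → s≤s (+-mono-≤ (steps≤ P i) (steps≤ Q i))
    ; size≤   = λ i → s≤s (+-mono-≤ (size≤ P i) (size≤ Q i))
    }

  ifᵗ : ∀ {B F G} → Γ ⟶ B → Γ ⟶ F → Γ ⟶ G →
        Γ ⟶ λ i → if isNode (B i) then F i else G i
  ifᵗ {B} {F} {G} C P Q = record
    { program = Program.if_then_else_ (program C) (program P) (program Q)
    ; time    = lit 1 ⊕ (time C ⊕ (time P ⊕ time Q))
    ; space   = space P ⊕ space Q
    ; steps   = λ i → suc (steps C i + (if isNode (B i) then steps P i else steps Q i))
    ; runs    = run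
    ; steps≤  = λ i → s≤s (+-mono-≤ (steps≤ C i) (branch≤ i))
    ; size≤   = size≤′
    }
    where
    run : ∀ i → Run (Program.if_then_else_ (program C) (program P) (program Q)) (Γ i)
                    (if isNode (B i) then F i else G i)
                    (suc (steps C i + (if isNode (B i) then steps P i else steps Q i)))
    run i with B i | runs C i
    ... | node _ _ | r = run-then r (λ ()) (runs P i)
    ... | leaf     | r = run-else r (runs Q i)
    branch≤ : ∀ i → (if isNode (B i) then steps P i else steps Q i) ≤
              eval (time P) (size (Γ i)) + eval (time Q) (size (Γ i))
    branch≤ i with B i
    ... | node _ _ = m≤n⇒m≤n+o _ (steps≤ P i)
    ... | leaf     = m≤n⇒m≤o+n _ (steps≤ Q i)
    size≤′ : ∀ i → size (if isNode (B i) then F i else G i) ≤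
             eval (space P) (size (Γ i)) + eval (space Q) (size (Γ i))
    size≤′ i with B i
    ... | node _ _ = m≤n⇒m≤n+o _ (size≤ P i)
    ... | leaf     = m≤n⇒m≤o+n _ (size≤ Q i)

  castᵗ : ∀ {F G} → (∀ i → F i ≡ G i) → Γ ⟶ F → Γ ⟶ G
  castᵗ F≗G P = record
    { program = program P ; time = time P ; space = space P ; steps = steps P
    ; runs    = λ i → subst (λ y → Run (program P) (Γ i) y (steps P i)) (F≗G i) (runs P i)
    ; steps≤  = steps≤ P
    ; size≤   = λ i → subst (λ y → size y ≤ _) (F≗G i) (size≤ P i)
    }

-- The program is uniform in the index, so it serves every family pulled back along `f`. This is how
-- subprograms are run under additional variables.
reindexᵗ : ∀ {I J : Set} {Γ F : I → Tree} (f : J → I) → Γ ⟶ F → Γ ∘ f ⟶ F ∘ f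
reindexᵗ f P = record
  { program = program P ; time = time P ; space = space P
  ; steps   = steps P ∘ f
  ; runs    = runs P ∘ f
  ; steps≤  = steps≤ P ∘ f
  ; size≤   = size≤ P ∘ f
  }

-- Loops over encoded lists

length≤size : ∀ ts → length ts ≤ size (encodeList ts)
length≤size []       = z≤n
length≤size (t ∷ ts) = s≤s (m≤n⇒m≤o+n (size t) (length≤size ts))

encL : ∀ {A : Set} → (A → Tree) → List A → Tree
encL e xs = encodeList (map e xs)

-- The step also sees the rest of the list: `upTo′` obtains the current number as its length.
foldSuffix : ∀ {A B : Set} → (A → List A → B → B) → B → List A → B
foldSuffix s b []       = b
foldSuffix s b (x ∷ xs) = foldSuffix s (s x xs b) xs

-- The additive growth condition keeps accumulators polynomially bounded.
module _ {I : Set} {Γ : I → Tree} {J A : I → Set}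
  (eJ : ∀ i → J i → Tree) (eA : ∀ i → A i → Tree)
  (s : ∀ i → J i → List (J i) → A i → A i) (growth : Polynomial)
  (grows : ∀ i x xs a → size (eA i (s i x xs a)) ≤
     size (eA i a) + eval growth (size (encL (eJ i) (x ∷ xs)) + size (Γ i)))
  (S : (λ ((i , x , xs , a) : Σ[ i ∈ I ] J i × List (J i) × A i) →
         node (encL (eJ i) (x ∷ xs)) (node (eA i a) (Γ i)))
       ⟶ λ (i , x , xs , a) → eA i (s i x xs a))
  where

  private
    -- The loop state is the remaining list, the accumulator and the context, nested to the right.
    -- `S` reads the whole state; the context is carried along unchanged.
    loopBody : Program
    loopBody = pair (hd ⨾ tl) (pair (program S) (tl ⨾ tl))

    -- The invariant reserves the growth of one step for each remaining entry. An iteration moves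
    -- one such share into the accumulator, which therefore never exceeds `bound`. The 10 counts the
    -- test, pairings and projections of one iteration; the final failing test costs 2.
    runLoop : ∀ i bound len →
      let τ = 10 + eval (time S) (1 + (len + (1 + (bound + size (Γ i))))) in
      ∀ xs a → size (encL (eJ i) xs) ≤ len →
      size (eA i a) + length xs * eval growth (len + size (Γ i)) ≤ bound →
      ∃[ t ] Run (while hd loop loopBody)
               (node (encL (eJ i) xs) (node (eA i a) (Γ i)))
               (node leaf (node (eA i (foldSuffix (s i) a xs)) (Γ i))) t
           × t ≤ 2 + length xs * τ
           × size (eA i (foldSuffix (s i) a xs)) ≤ bound
    runLoop i bound len [] a _ a≤ =
      2 , run-stop run-hd , ≤-refl , ≤-trans (m≤m+n _ _) a≤
    runLoop i bound len (x ∷ xs) a l≤ a≤ =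
      let t , r , t≤ , a≤′ = runLoop i bound len xs (s i x xs a)
            (≤-trans (m≤n⇒m≤1+n (m≤n+m _ (size (eJ i x)))) l≤) grown in
      _ , run-loop run-hd (λ ())
            (run-pair (run-⨾ run-hd run-tl)
              (run-pair (runs S (i , x , xs , a)) (run-⨾ run-tl run-tl))) r
        , time≤ t≤
        , a≤′
      where
      open ≤-Reasoning
      g = eval growth (len + size (Γ i))
      τ = 10 + eval (time S) (1 + (len + (1 + (bound + size (Γ i)))))
      grown : size (eA i (s i x xs a)) + length xs * g ≤ bound
      grown = begin
        size (eA i (s i x xs a)) + length xs * g
          ≤⟨ +-monoˡ-≤ _ (grows i x xs a) ⟩
        (size (eA i a) + eval growth _) + length xs * g
          ≤⟨ +-monoˡ-≤ _ (+-monoʳ-≤ (size (eA i a))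
               (eval-mono growth (+-monoˡ-≤ (size (Γ i)) l≤))) ⟩
        (size (eA i a) + g) + length xs * g ≡⟨ +-assoc (size (eA i a)) g _ ⟩
        size (eA i a) + suc (length xs) * g ≤⟨ a≤ ⟩
        bound ∎
      step≤ : steps S (i , x , xs , a) ≤
              eval (time S) (1 + (len + (1 + (bound + size (Γ i)))))
      step≤ = ≤-trans (steps≤ S _) (eval-mono (time S)
        (s≤s (+-mono-≤ l≤ (s≤s (+-monoˡ-≤ _ (≤-trans (m≤m+n _ _) a≤))))))
      time≤ : ∀ {t} → t ≤ 2 + length xs * τ →
        suc (1 + suc (3 + suc (steps S (i , x , xs , a) + 3)) + t) ≤
        2 + suc (length xs) * τ
      time≤ {t} t≤ = begin
        7 + (u + 3) + t          ≡⟨ cong (λ z → 7 + z + t) (+-comm u 3) ⟩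
        10 + u + t               ≤⟨ +-mono-≤ (+-monoʳ-≤ 10 step≤) t≤ ⟩
        τ + (2 + length xs * τ)  ≡⟨ +-assoc τ 2 _ ⟨
        τ + 2 + length xs * τ    ≡⟨ cong (_+ length xs * τ) (+-comm τ 2) ⟩
        2 + τ + length xs * τ    ≡⟨ +-assoc 2 τ _ ⟩
        2 + suc (length xs) * τ  ∎
        where u = steps S (i , x , xs , a)

  foldSuffixᵗ : {l : ∀ i → List (J i)} {z : ∀ i → A i} →
    Γ ⟶ (λ i → encL (eJ i) (l i)) → Γ ⟶ (λ i → eA i (z i)) →
    Γ ⟶ (λ i → eA i (foldSuffix (s i) (z i) (l i)))
  foldSuffixᵗ {l} {z} L Z = record
    { program = pair (program L) (pair (program Z) idp)
                ⨾ ((while hd loop loopBody) ⨾ (tl ⨾ hd))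
    ; time    = lit 1 ⊕ ((lit 1 ⊕ (time L ⊕ (lit 1 ⊕ (time Z ⊕ lit 1))))
                ⊕ (lit 1 ⊕ ((lit 2 ⊕ (space L ⊗ iteration)) ⊕ lit 3)))
    ; space   = bound
    ; steps   = λ i → _
    ; runs    = λ i → run-⨾
        (run-pair (runs L i) (run-pair (runs Z i) run-idp))
        (run-⨾ (proj₁ (proj₂ (result i))) (run-⨾ run-tl run-hd))
    ; steps≤  = λ i → s≤s (+-mono-≤
        (s≤s (+-mono-≤ (steps≤ L i) (s≤s (+-monoˡ-≤ 1 (steps≤ Z i)))))
        (s≤s (+-monoˡ-≤ 3 (≤-trans (proj₁ (proj₂ (proj₂ (result i))))
          (s≤s (s≤s (*-mono-≤ (len≤ i) (≤-reflexive (iteration≡ i)))))))))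
    ; size≤   = λ i → proj₂ (proj₂ (proj₂ (result i)))
    }
    where
    bound iteration : Polynomial
    -- A list has at most as many entries as its encoding has nodes, so `space L` bounds the number
    -- of iterations as well.
    bound     = space Z ⊕ (space L ⊗ (growth ∘ᵖ (space L ⊕ var)))
    iteration = lit 10 ⊕ (time S ∘ᵖ (lit 1 ⊕ (space L ⊕ (lit 1 ⊕ (bound ⊕ var)))))
    len≤ : ∀ i → length (l i) ≤ eval (space L) (size (Γ i))
    len≤ i = ≤-trans (≤-trans (≤-reflexive (sym (List.length-map (eJ i) (l i))))
      (length≤size (map (eJ i) (l i)))) (size≤ L i)
    iteration≡ : ∀ i → 10 + eval (time S) (1 + (eval (space L) (size (Γ i))
        + (1 + (eval bound (size (Γ i)) + size (Γ i)))))
      ≡ eval iteration (size (Γ i))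
    iteration≡ i = cong (10 +_) (sym (eval-∘ᵖ (time S) _ (size (Γ i))))
    result = λ i → runLoop i (eval bound (size (Γ i))) (eval (space L) (size (Γ i)))
      (l i) (z i) (size≤ L i)
      (+-mono-≤ (size≤ Z i) (*-mono-≤ (len≤ i)
        (≤-reflexive (sym (eval-∘ᵖ growth (space L ⊕ var) (size (Γ i)))))))

polyTime : ∀ {I : Set} {encode F : I → Tree} {Correct : I → Tree → Set} →
  encode ⟶ F → (∀ i → Correct i (F i)) → PolyTime encode Correct
polyTime {encode = encode} {F} P correct =
  let a , d , time≤ = eval≤monomial (time P) in
  program P , a , d , λ i → F i , steps P i , runs P i ,
    (begin
      steps P i                         ≤⟨ steps≤ P i ⟩
      eval (time P) (size (encode i))   ≤⟨ time≤ (size (encode i)) {{>-nonZero (1≤size (encode i))}} ⟩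
      a * size (encode i) ^ d           ≤⟨ m≤m+n _ a ⟩
      a * size (encode i) ^ d + a       ∎) ,
    correct i
  where open ≤-Reasoning

-- Typed programs over encoded data

infixr 7 _⊠_

-- The code of a type fixes the encoding. Ranges `fin n` and vectors `vec n A` have lengths
-- depending on the instance, which is why programs are typed by families `I → Ty`. Vectors are
-- functions, so that the algorithm is stated in ordinary terms.
data Ty : Set where
  unit bool nat : Ty
  fin           : ℕ → Ty
  _⊠_           : Ty → Ty → Ty
  list          : Ty → Ty
  vec           : ℕ → Ty → Ty

El : Ty → Set
El unit      = Unit.⊤
El bool      = Bool
El nat       = ℕ
El (fin n)   = Fin n
El (A ⊠ B)   = El A × El B
El (list A)  = List (El A)
El (vec n A) = Fin n → El A

enc : ∀ A → El A → Tree
enc unit      _       = leaf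
enc bool      b       = encodeBool b
enc nat       n       = encodeℕ n
enc (fin n)   j       = encodeℕ (toℕ j)
enc (A ⊠ B)   (x , y) = node (enc A x) (enc B y)
enc (list A)  xs      = encodeList (map (enc A) xs)
enc (vec n A) f       = encodeList (List.tabulate (enc A ∘ f))

infix 2 _⊢_∋_

-- A shallow embedding: Γ is a context of encoded values, _▹_ extends it by a
-- variable, and f is a function of these values computed by one program.
record _⊢_∋_ {I : Set} (Γ : I → Tree) (A : I → Ty) (f : ∀ i → El (A i)) : Set where
  constructor ⟪_⟫
  field
    raw : Γ ⟶ λ i → enc (A i) (f i)

open _⊢_∋_

infixl 5 _▹_

_▹_ : ∀ {I : Set} (Γ : I → Tree) (A : I → Ty) → Σ I (El ∘ A) → Tree
(Γ ▹ A) (i , a) = node (enc (A i) a) (Γ i)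

private
  variable
    I     : Set
    Γ     : I → Tree
    A B C : I → Ty
    ν     : I → ℕ

-- Only the trees matter: values of different types with equal encodings, such as a number and a
-- list of units, are computed by the same program.
recode : {f : ∀ i → El (A i)} {g : ∀ i → El (B i)} → (∀ i → enc (A i) (f i) ≡ enc (B i) (g i)) →
         Γ ⊢ A ∋ f → Γ ⊢ B ∋ g
recode eq P = ⟪ castᵗ eq (raw P) ⟫

reval : {f g : ∀ i → El (A i)} → (∀ i → f i ≡ g i) → Γ ⊢ A ∋ f → Γ ⊢ A ∋ g
reval {A = A} eq = recode (λ i → cong (enc (A i)) (eq i))

var₀ : Γ ▹ A ⊢ A ∘ proj₁ ∋ proj₂
var₀ = ⟪ headᵗ ⟫

wk : {f : ∀ i → El (A i)} → Γ ⊢ A ∋ f → Γ ▹ B ⊢ A ∘ proj₁ ∋ f ∘ proj₁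
wk P = ⟪ tailᵗ ⨾ᵗ reindexᵗ proj₁ (raw P) ⟫

star : Γ ⊢ const unit ∋ const tt
star = ⟪ leafᵗ ⟫

false′ : Γ ⊢ const bool ∋ const false
false′ = ⟪ leafᵗ ⟫

true′ : Γ ⊢ const bool ∋ const true
true′ = ⟪ nodeᵗ leafᵗ leafᵗ ⟫

suc′ : {n : I → ℕ} → Γ ⊢ const nat ∋ n → Γ ⊢ const nat ∋ suc ∘ n
suc′ P = ⟪ nodeᵗ leafᵗ (raw P) ⟫

toℕ′ : {n : I → ℕ} {j : ∀ i → Fin (n i)} → Γ ⊢ fin ∘ n ∋ j → Γ ⊢ const nat ∋ (λ i → toℕ (j i))
toℕ′ P = ⟪ raw P ⟫

_,′_ : {f : ∀ i → El (A i)} {g : ∀ i → El (B i)} → Γ ⊢ A ∋ f → Γ ⊢ B ∋ g →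
       Γ ⊢ (λ i → A i ⊠ B i) ∋ (λ i → f i , g i)
P ,′ Q = ⟪ nodeᵗ (raw P) (raw Q) ⟫

fst′ : {f : ∀ i → El (A i ⊠ B i)} → Γ ⊢ (λ i → A i ⊠ B i) ∋ f → Γ ⊢ A ∋ (λ i → proj₁ (f i))
fst′ P = ⟪ raw P ⨾ᵗ headᵗ ⟫

snd′ : {f : ∀ i → El (A i ⊠ B i)} → Γ ⊢ (λ i → A i ⊠ B i) ∋ f → Γ ⊢ B ∋ (λ i → proj₂ (f i))
snd′ P = ⟪ raw P ⨾ᵗ tailᵗ ⟫

[]′ : Γ ⊢ (λ i → list (A i)) ∋ (λ _ → [])
[]′ = ⟪ leafᵗ ⟫

infixr 5 _∷′_ _++′_

_∷′_ : {f : ∀ i → El (A i)} {l : ∀ i → List (El (A i))} → Γ ⊢ A ∋ f → Γ ⊢ (λ i → list (A i)) ∋ l →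
       Γ ⊢ (λ i → list (A i)) ∋ (λ i → f i ∷ l i)
P ∷′ Q = ⟪ nodeᵗ (raw P) (raw Q) ⟫

if′ : {b : I → Bool} {f g : ∀ i → El (A i)} → Γ ⊢ const bool ∋ b → Γ ⊢ A ∋ f → Γ ⊢ A ∋ g →
      Γ ⊢ A ∋ (λ i → if b i then f i else g i)
if′ {A = A} {b = b} {f} {g} B P Q = ⟪ castᵗ eq (ifᵗ (raw B) (raw P) (raw Q)) ⟫
  where
  eq : ∀ i → (if isNode (encodeBool (b i)) then enc (A i) (f i) else enc (A i) (g i))
             ≡ enc (A i) (if b i then f i else g i)
  eq i with b i
  ... | true  = refl
  ... | false = refl

not′ : {b : I → Bool} → Γ ⊢ const bool ∋ b → Γ ⊢ const bool ∋ (λ i → not (b i))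
not′ {b = b} P = reval eq (if′ P false′ true′)
  where
  eq : ∀ i → (if b i then false else true) ≡ not (b i)
  eq i with b i
  ... | true  = refl
  ... | false = refl

infixr 6 _∧′_ _∨′_

_∧′_ : {b c : I → Bool} → Γ ⊢ const bool ∋ b → Γ ⊢ const bool ∋ c →
       Γ ⊢ const bool ∋ (λ i → b i ∧ c i)
_∧′_ {b = b} {c} P Q = reval eq (if′ P Q false′)
  where
  eq : ∀ i → (if b i then c i else false) ≡ b i ∧ c i
  eq i with b i
  ... | true  = refl
  ... | false = refl

_∨′_ : {b c : I → Bool} → Γ ⊢ const bool ∋ b → Γ ⊢ const bool ∋ c →
       Γ ⊢ const bool ∋ (λ i → b i ∨ c i)
_∨′_ {b = b} {c} P Q = reval eq (if′ P true′ Q)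
  where
  eq : ∀ i → (if b i then true else c i) ≡ b i ∨ c i
  eq i with b i
  ... | true  = refl
  ... | false = refl

-- Folds and list operations

foldl′ : {l : ∀ i → List (El (C i))} {z : ∀ i → El (A i)}
  {s : ∀ i → El (A i) → El (C i) → El (A i)} (growth : Polynomial) →
  (∀ i a x → size (enc (A i) (s i a x)) ≤
     size (enc (A i) a) + eval growth (size (enc (C i) x) + size (Γ i))) →
  Γ ▹ A ▹ C ∘ proj₁ ⊢ A ∘ proj₁ ∘ proj₁ ∋
    (λ p → s (proj₁ (proj₁ p)) (proj₂ (proj₁ p)) (proj₂ p)) →
  Γ ⊢ A ∋ z → Γ ⊢ (λ i → list (C i)) ∋ l →
  Γ ⊢ A ∋ (λ i → foldl (s i) (z i) (l i))
foldl′ {C = C} {A = A} {Γ = Γ} {l = l} {z} {s} growth grows S Z L =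
  ⟪ castᵗ (λ i → cong (enc (A i)) (foldSuffix-foldl (s i) (z i) (l i)))
     (foldSuffixᵗ (λ i → enc (C i)) (λ i → enc (A i)) (λ i x _ a → s i a x) growth
       (λ i x xs a → ≤-trans (grows i a x) (+-monoʳ-≤ (size (enc (A i) a))
         (eval-mono growth (+-monoˡ-≤ (size (Γ i))
           (m≤n⇒m≤1+n (m≤m+n (size (enc (C i) x)) _))))))
       -- Replaces the remaining list in the loop state by its first entry, which yields the context
       -- that `S` expects.
       (nodeᵗ (headᵗ ⨾ᵗ headᵗ) tailᵗ ⨾ᵗ
         reindexᵗ (λ (i , x , xs , a) → (i , a) , x) (raw S))
       {l} {z} (raw L) (raw Z)) ⟫
  where
  foldSuffix-foldl : ∀ {A B : Set} (s : B → A → B) b xs →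
    foldSuffix (λ x _ b → s b x) b xs ≡ foldl s b xs
  foldSuffix-foldl s b []       = refl
  foldSuffix-foldl s b (x ∷ xs) = foldSuffix-foldl s (s b x) xs

node-grows : ∀ t u n → size (node t u) ≤ size u + (1 + (size t + n))
node-grows t u n = begin
  1 + (size t + size u)      ≡⟨ cong suc (+-comm (size t) (size u)) ⟩
  1 + (size u + size t)      ≡⟨ +-suc (size u) (size t) ⟨
  size u + (1 + size t)      ≤⟨ +-monoʳ-≤ (size u) (s≤s (m≤m+n (size t) n)) ⟩
  size u + (1 + (size t + n)) ∎
  where open ≤-Reasoning

reverse′ : {l : ∀ i → List (El (A i))} → Γ ⊢ (λ i → list (A i)) ∋ l →
           Γ ⊢ (λ i → list (A i)) ∋ (λ i → reverse (l i))
reverse′ {A = A} {Γ = Γ} = foldl′ (lit 1 ⊕ var)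
  (λ i a x → node-grows (enc (A i) x) (enc (list (A i)) a) (size (Γ i)))
  (var₀ ∷′ wk var₀) []′

-- Loops consume lists from the front, so a right fold is a left fold over the reversed list.
foldr′ : {l : ∀ i → List (El (C i))} {z : ∀ i → El (A i)}
  {s : ∀ i → El (C i) → El (A i) → El (A i)} (growth : Polynomial) →
  (∀ i x a → size (enc (A i) (s i x a)) ≤
     size (enc (A i) a) + eval growth (size (enc (C i) x) + size (Γ i))) →
  Γ ▹ A ▹ C ∘ proj₁ ⊢ A ∘ proj₁ ∘ proj₁ ∋
    (λ p → s (proj₁ (proj₁ p)) (proj₂ p) (proj₂ (proj₁ p))) →
  Γ ⊢ A ∋ z → Γ ⊢ (λ i → list (C i)) ∋ l →
  Γ ⊢ A ∋ (λ i → foldr (s i) (z i) (l i))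
foldr′ {A = A} {l = l} {z} {s} growth grows S Z L =
  reval (λ i → List.reverse-foldl (flip (s i)) (z i) (l i))
    (foldl′ {s = λ i → flip (s i)} growth (λ i a x → grows i x a) S Z (reverse′ L))

_++′_ : {l m : ∀ i → List (El (A i))} → Γ ⊢ (λ i → list (A i)) ∋ l → Γ ⊢ (λ i → list (A i)) ∋ m →
        Γ ⊢ (λ i → list (A i)) ∋ (λ i → l i ++ m i)
_++′_ {A = A} {Γ = Γ} {l = l} {m} P Q =
  reval (λ i → sym (List.++-is-foldr (l i) (m i)))
  (foldr′ {s = λ i → _∷_} (lit 1 ⊕ var)
    (λ i x a → node-grows (enc (A i) x) (enc (list (A i)) a) (size (Γ i)))
    (var₀ ∷′ wk var₀) Q P)
size-++ : ∀ ts us → size (encodeList (ts ++ us)) ≤ size (encodeList us) + size (encodeList ts)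
size-++ []       us = m≤m+n _ _
size-++ (t ∷ ts) us = begin
  1 + (size t + size (encodeList (ts ++ us)))
    ≤⟨ s≤s (+-monoʳ-≤ (size t) (size-++ ts us)) ⟩
  1 + (size t + (size (encodeList us) + size (encodeList ts)))
    ≡⟨ solve 3 (λ t u v → con 1 :+ (t :+ (u :+ v)) := u :+ (con 1 :+ (t :+ v)))
         refl (size t) (size (encodeList us)) (size (encodeList ts)) ⟩
  size (encodeList us) + (1 + (size t + size (encodeList ts))) ∎
  where
  open ≤-Reasoning
  open +-*-Solver

-- One step adds the output of `g`, whose size is bounded by the space polynomial of its program
-- independently of the accumulator; this is the growth condition. Mapping, filtering and products
-- are special cases.
concatMap′ : {l : ∀ i → List (El (C i))} {g : ∀ i → El (C i) → List (El (A i))} →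
  Γ ▹ C ⊢ (λ p → list (A (proj₁ p))) ∋ uncurry g →
  Γ ⊢ (λ i → list (C i)) ∋ l →
  Γ ⊢ (λ i → list (A i)) ∋ (λ i → concatMap (g i) (l i))
concatMap′ {C = C} {A = A} {Γ = Γ} {l = l} {g = g} G L =
  reval (λ i → sym (List.foldr-map _++_ (g i) [] (l i)))
    (foldr′ {l = l} {z = λ _ → []} {s = λ i x a → g i x ++ a} (space (raw G) ∘ᵖ (lit 1 ⊕ var)) grows
      (reassoc ++′ wk var₀) []′ L)
  where
  reassoc : Γ ▹ (λ i → list (A i)) ▹ C ∘ proj₁ ⊢ (λ p → list (A (proj₁ (proj₁ p)))) ∋
            (λ p → g (proj₁ (proj₁ p)) (proj₂ p))
  reassoc = ⟪ nodeᵗ headᵗ (tailᵗ ⨾ᵗ tailᵗ) ⨾ᵗ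
    reindexᵗ (λ p → proj₁ (proj₁ p) , proj₂ p) (raw G) ⟫
  grows : ∀ i x a → size (enc (list (A i)) (g i x ++ a)) ≤
    size (enc (list (A i)) a) +
    eval (space (raw G) ∘ᵖ (lit 1 ⊕ var)) (size (enc (C i) x) + size (Γ i))
  grows i x a = begin
    size (encodeList (map (enc (A i)) (g i x ++ a)))
      ≡⟨ cong (size ∘ encodeList) (List.map-++ (enc (A i)) (g i x) a) ⟩
    size (encodeList (map (enc (A i)) (g i x) ++ map (enc (A i)) a))
      ≤⟨ size-++ (map (enc (A i)) (g i x)) (map (enc (A i)) a) ⟩
    size (enc (list (A i)) a) + size (enc (list (A i)) (g i x))
      ≤⟨ +-monoʳ-≤ (size (enc (list (A i)) a)) (≤-trans (size≤ (raw G) (i , x))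
           (≤-reflexive (sym (eval-∘ᵖ (space (raw G)) (lit 1 ⊕ var) _)))) ⟩
    size (enc (list (A i)) a) +
      eval (space (raw G) ∘ᵖ (lit 1 ⊕ var)) (size (enc (C i) x) + size (Γ i)) ∎
    where open ≤-Reasoning

map′ : {l : ∀ i → List (El (C i))} {g : ∀ i → El (C i) → El (A i)} →
  Γ ▹ C ⊢ A ∘ proj₁ ∋ uncurry g → Γ ⊢ (λ i → list (C i)) ∋ l →
  Γ ⊢ (λ i → list (A i)) ∋ (λ i → map (g i) (l i))
map′ {l = l} {g} G L = reval (λ i → concatMap-[] (g i) (l i))
  (concatMap′ {g = λ i x → g i x ∷ []} (G ∷′ []′) L)
  where
  concatMap-[] : ∀ {A B : Set} (g : A → B) xs → concatMap (λ x → g x ∷ []) xs ≡ map g xs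
  concatMap-[] g []       = refl
  concatMap-[] g (x ∷ xs) = cong (g x ∷_) (concatMap-[] g xs)

filterᵇ′ : {l : ∀ i → List (El (C i))} {p : ∀ i → El (C i) → Bool} →
  Γ ▹ C ⊢ const bool ∋ uncurry p → Γ ⊢ (λ i → list (C i)) ∋ l →
  Γ ⊢ (λ i → list (C i)) ∋ (λ i → filterᵇ (p i) (l i))
filterᵇ′ {l = l} {p} P L = reval (λ i → eq (p i) (l i))
  (concatMap′ {g = λ i x → if p i x then x ∷ [] else []} (if′ P (var₀ ∷′ []′) []′) L)
  where
  eq : ∀ {A : Set} (p : A → Bool) xs →
       concatMap (λ x → if p x then x ∷ [] else []) xs ≡ filterᵇ p xs
  eq p []       = refl
  eq p (x ∷ xs) with p x
  ... | true  = cong (x ∷_) (eq p xs)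
  ... | false = eq p xs

cartesianProduct′ : {l : ∀ i → List (El (A i))} {m : ∀ i → List (El (B i))} →
  Γ ⊢ (λ i → list (A i)) ∋ l → Γ ⊢ (λ i → list (B i)) ∋ m →
  Γ ⊢ (λ i → list (A i ⊠ B i)) ∋ (λ i → cartesianProduct (l i) (m i))
cartesianProduct′ {A = A} {B = B} {l = l} {m} L M = reval (λ i → eq (l i) (m i))
  (concatMap′ {g = λ i x → map (x ,_) (m i)}
    (map′ {A = λ p → A (proj₁ p) ⊠ B (proj₁ p)} {g = λ p → proj₂ p ,_}
      (wk var₀ ,′ var₀) (wk M))
    L)
  where
  eq : ∀ {A B : Set} (xs : List A) (ys : List B) →
       concatMap (λ x → map (x ,_) ys) xs ≡ cartesianProduct xs ys
  eq []       ys = refl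
  eq (x ∷ xs) ys = cong (map (x ,_) ys ++_) (eq xs ys)

length′ : {l : ∀ i → List (El (A i))} → Γ ⊢ (λ i → list (A i)) ∋ l →
  Γ ⊢ const nat ∋ (λ i → length (l i))
length′ {l = l} L = recode (λ i → cong encodeList (eq (l i)))
  (map′ {A = const unit} {g = λ _ _ → tt} star L)
  where
  eq : ∀ {A : Set} (xs : List A) →
       map (const leaf) (map (const tt) xs) ≡ replicate (length xs) leaf
  eq []       = refl
  eq (x ∷ xs) = cong (leaf ∷_) (eq xs)

-- Arithmetic on unary numbers, through lists of units

units′ : {n : I → ℕ} → Γ ⊢ const nat ∋ n →
  Γ ⊢ const (list unit) ∋ (λ i → replicate (n i) tt)
units′ {n = n} N = recode (λ i → cong encodeList (sym (List.map-replicate (const leaf) (n i) tt))) N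

_+′_ : {m n : I → ℕ} → Γ ⊢ const nat ∋ m → Γ ⊢ const nat ∋ n →
  Γ ⊢ const nat ∋ (λ i → m i + n i)
_+′_ {m = m} {n} M N = reval (λ i → trans (List.length-++ (replicate (m i) tt))
    (cong₂ _+_ (List.length-replicate (m i)) (List.length-replicate (n i))))
  (length′ (units′ M ++′ units′ N))

length-cartesianProduct : ∀ {A B : Set} (xs : List A) (ys : List B) →
  length (cartesianProduct xs ys) ≡ length xs * length ys
length-cartesianProduct []       ys = refl
length-cartesianProduct (x ∷ xs) ys = trans (List.length-++ (map (x ,_) ys))
  (cong₂ _+_ (List.length-map (x ,_) ys) (length-cartesianProduct xs ys))

_*′_ : {m n : I → ℕ} → Γ ⊢ const nat ∋ m → Γ ⊢ const nat ∋ n →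
  Γ ⊢ const nat ∋ (λ i → m i * n i)
_*′_ {m = m} {n} M N = reval (λ i → trans
    (length-cartesianProduct (replicate (m i) tt) (replicate (n i) tt))
    (cong₂ _*_ (List.length-replicate (m i)) (List.length-replicate (n i))))
  (length′ (cartesianProduct′ (units′ M) (units′ N)))

drop′ : {m : I → ℕ} {l : ∀ i → List (El (A i))} → Γ ⊢ const nat ∋ m →
  Γ ⊢ (λ i → list (A i)) ∋ l → Γ ⊢ (λ i → list (A i)) ∋ (λ i → drop (m i) (l i))
drop′ {A = A} {m = m} {l} M L = reval (λ i → eq (m i) (l i))
  (foldl′ {s = λ _ xs _ → drop 1 xs} (lit 0)
    (λ i xs _ → m≤n⇒m≤n+o 0 (shrinks (enc (A i)) xs))
    ⟪ castᵗ (λ ((i , xs) , _) → tail-encode (enc (A i)) xs)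
        (tailᵗ ⨾ᵗ headᵗ ⨾ᵗ tailᵗ) ⟫
    L (units′ M))
  where
  tail-encode : ∀ {A : Set} (e : A → Tree) xs →
    tail (encodeList (map e xs)) ≡ encodeList (map e (drop 1 xs))
  tail-encode e []       = refl
  tail-encode e (x ∷ xs) = refl
  shrinks : ∀ {A : Set} (e : A → Tree) xs →
    size (encodeList (map e (drop 1 xs))) ≤ size (encodeList (map e xs))
  shrinks e xs = subst (λ t → size t ≤ size (encodeList (map e xs)))
    (tail-encode e xs) (size-tail (encodeList (map e xs)))
  eq : ∀ {A : Set} m (xs : List A) →
       foldl (λ xs _ → drop 1 xs) xs (replicate m tt) ≡ drop m xs
  eq zero    xs = refl
  eq (suc m) xs = trans (eq m (drop 1 xs)) (List.drop-drop 1 m xs)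

nonZero′ : {m : I → ℕ} → Γ ⊢ const nat ∋ m → Γ ⊢ const bool ∋ (λ i → 0 <ᵇ m i)
nonZero′ {m = m} M = ⟪ castᵗ eq (ifᵗ (raw M) (raw true′) (raw false′)) ⟫
  where
  eq : ∀ i → (if isNode (encodeℕ (m i)) then encodeBool true else encodeBool false)
             ≡ encodeBool (0 <ᵇ m i)
  eq i with m i
  ... | zero  = refl
  ... | suc _ = refl

_<ᵇ′_ : {m n : I → ℕ} → Γ ⊢ const nat ∋ m → Γ ⊢ const nat ∋ n →
  Γ ⊢ const bool ∋ (λ i → m i <ᵇ n i)
_<ᵇ′_ {m = m} {n} M N = reval (λ i → eq (m i) (n i))
  (nonZero′ (length′ (drop′ M (units′ N))))
  where
  eq : ∀ m n → (0 <ᵇ length (drop m (replicate n tt))) ≡ (m <ᵇ n)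
  eq zero    zero    = refl
  eq zero    (suc n) = refl
  eq (suc m) zero    = refl
  eq (suc m) (suc n) = eq m n

_≡ᵇ′_ : {m n : I → ℕ} → Γ ⊢ const nat ∋ m → Γ ⊢ const nat ∋ n →
  Γ ⊢ const bool ∋ (λ i → m i ≡ᵇ n i)
_≡ᵇ′_ {m = m} {n} M N = reval (λ i → eq (m i) (n i))
  (not′ ((M <ᵇ′ N) ∨′ (N <ᵇ′ M)))
  where
  eq : ∀ m n → not ((m <ᵇ n) ∨ (n <ᵇ m)) ≡ (m ≡ᵇ n)
  eq zero    zero    = refl
  eq zero    (suc n) = refl
  eq (suc m) zero    = refl
  eq (suc m) (suc n) = eq m n

upTo′ : {n : I → ℕ} → Γ ⊢ const nat ∋ n → Γ ⊢ const (list nat) ∋ (λ i → upTo (n i))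
upTo′ {Γ = Γ} {n = n} N =
  ⟪ castᵗ (λ i → cong (enc (list nat)) (trans (eq (n i) []) (List.++-identityʳ (upTo (n i)))))
      (foldSuffixᵗ (λ _ → enc unit) (λ _ → enc (list nat)) (λ _ _ xs a → length xs ∷ a) var
        grows
        (nodeᵗ (castᵗ (λ (_ , _ , xs , _) → cong encodeList (eq′ xs)) (headᵗ ⨾ᵗ tailᵗ))
          (tailᵗ ⨾ᵗ headᵗ))
        {λ i → replicate (n i) tt} {λ _ → []} (raw (units′ N)) leafᵗ) ⟫
  where
  eq′ : ∀ xs → map (enc unit) xs ≡ replicate (length xs) leaf
  eq′ []       = refl
  eq′ (x ∷ xs) = cong (leaf ∷_) (eq′ xs)
  grows : ∀ i (x : Unit.⊤) xs a → size (enc (list nat) (length xs ∷ a)) ≤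
    size (enc (list nat) a) + (size (encodeList (map (enc unit) (x ∷ xs))) + size (Γ i))
  grows i x xs a = ≤-trans (node-grows (encodeℕ (length xs)) (enc (list nat) a) 0)
    (+-monoʳ-≤ (size (enc (list nat) a)) (≤-trans
      (s≤s (≤-reflexive (trans (+-identityʳ _) (cong (size ∘ encodeList) (sym (eq′ xs))))))
      (m≤n⇒m≤n+o _ (n≤1+n _))))
  eq : ∀ n acc → foldSuffix (λ _ xs a → length xs ∷ a) acc (replicate n tt) ≡ upTo n ++ acc
  eq zero    acc = refl
  eq (suc n) acc = trans
    (cong (λ m → foldSuffix _ (m ∷ acc) (replicate n tt)) (List.length-replicate n))
    (trans (eq n (n ∷ acc))
      (trans (sym (List.++-assoc (upTo n) (n ∷ []) acc)) (cong (_++ acc) (List.upTo-∷ʳ n))))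

-- Index ranges, vectors and matrices

allFin′ : {n : I → ℕ} → Γ ⊢ const nat ∋ n →
  Γ ⊢ (λ i → list (fin (n i))) ∋ (λ i → allFin (n i))
allFin′ {n = n} N = recode (λ i → cong encodeList (begin
    map encodeℕ (upTo (n i))             ≡⟨ cong (map encodeℕ) (eq id (n i)) ⟨
    map encodeℕ (List.tabulate toℕ)      ≡⟨ cong (map encodeℕ) (List.map-tabulate id toℕ) ⟨
    map encodeℕ (map toℕ (allFin (n i))) ≡⟨ List.map-∘ (allFin (n i)) ⟨
    map (encodeℕ ∘ toℕ) (allFin (n i))   ∎)) (upTo′ N)
  where
  open ≡-Reasoning
  eq : ∀ {A : Set} (f : ℕ → A) n → List.tabulate {n = n} (f ∘ toℕ) ≡ List.applyUpTo f n
  eq f zero    = refl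
  eq f (suc n) = cong (f 0 ∷_) (eq (f ∘ suc) n)

tabulate′ : {n : I → ℕ} {f : ∀ i → Fin (n i) → El (A i)} →
  Γ ⊢ (λ i → list (fin (n i))) ∋ (λ i → allFin (n i)) →
  Γ ▹ (λ i → fin (n i)) ⊢ A ∘ proj₁ ∋ uncurry f →
  Γ ⊢ (λ i → vec (n i) (A i)) ∋ f
tabulate′ {A = A} {f = f} V F = recode
  (λ i → cong encodeList (trans (cong (map (enc (A i))) (List.map-tabulate id (f i)))
    (List.map-tabulate (f i) (enc (A i)))))
  (map′ F V)

toList′ : {n : I → ℕ} {f : ∀ i → Fin (n i) → El (A i)} →
  Γ ⊢ (λ i → vec (n i) (A i)) ∋ f →
  Γ ⊢ (λ i → list (A i)) ∋ (λ i → List.tabulate (f i))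
toList′ {A = A} {f = f} =
  recode (λ i → cong encodeList (sym (List.map-tabulate (f i) (enc (A i)))))

lookup′ : {n : I → ℕ} {f : ∀ i → Fin (n i) → El (A i)} {j : ∀ i → Fin (n i)} →
  Γ ⊢ (λ i → vec (n i) (A i)) ∋ f → Γ ⊢ (λ i → fin (n i)) ∋ j →
  Γ ⊢ A ∋ (λ i → f i (j i))
lookup′ {A = A} {f = f} {j} F K =
  ⟪ castᵗ (λ i → head-drop (enc (A i)) (f i) (j i))
      (raw (drop′ (toℕ′ K) (toList′ F)) ⨾ᵗ headᵗ) ⟫
  where
  head-drop : ∀ {A : Set} (e : A → Tree) {n} (f : Fin n → A) j →
    head (encodeList (map e (drop (toℕ j) (List.tabulate f)))) ≡ e (f j)
  head-drop e f Fin.zero    = refl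
  head-drop e f (Fin.suc j) = head-drop e (f ∘ Fin.suc) j

tabulate-+ : ∀ {A : Set} m {n} (f : Fin (m + n) → A) →
  List.tabulate f ≡ List.tabulate (f ∘ (Fin._↑ˡ n)) ++ List.tabulate (f ∘ (m Fin.↑ʳ_))
tabulate-+ zero    f = refl
tabulate-+ (suc m) f = cong (f Fin.zero ∷_) (tabulate-+ m (f ∘ Fin.suc))

cartesianProduct-map₁ : ∀ {A B C : Set} (f : A → B) xs (ys : List C) →
  cartesianProduct (map f xs) ys ≡ map (Product.map₁ f) (cartesianProduct xs ys)
cartesianProduct-map₁ f []       ys = refl
cartesianProduct-map₁ f (x ∷ xs) ys = begin
  map (f x ,_) ys ++ cartesianProduct (map f xs) ys
    ≡⟨ cong₂ _++_ (List.map-∘ ys) (cartesianProduct-map₁ f xs ys) ⟩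
  map (Product.map₁ f) (map (x ,_) ys) ++ map (Product.map₁ f) (cartesianProduct xs ys)
    ≡⟨ List.map-++ (Product.map₁ f) (map (x ,_) ys) (cartesianProduct xs ys) ⟨
  map (Product.map₁ f) (map (x ,_) ys ++ cartesianProduct xs ys) ∎
  where open ≡-Reasoning

remQuot-↑ʳ : ∀ n m (y : Fin (n * m)) →
  remQuot {suc n} m (m Fin.↑ʳ y) ≡ Product.map₁ Fin.suc (remQuot {n} m y)
remQuot-↑ʳ n m y rewrite Fin.splitAt-↑ʳ m (n * m) y = refl

-- `remQuot` runs through pairs in lexicographic order, the order of nested loops. Vectors indexed
-- by encoded pairs can thus be produced by product loops without a program for division, and counts
-- over `Fin (n * m)` become counts over pairs.
tabulate-remQuot : ∀ {A : Set} n m (f : Fin n × Fin m → A) →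
  List.tabulate (f ∘ remQuot {n} m) ≡ map f (cartesianProduct (allFin n) (allFin m))
tabulate-remQuot zero    m f = refl
tabulate-remQuot (suc n) m f = begin
  List.tabulate (f ∘ remQuot {suc n} m)
    ≡⟨ tabulate-+ m (f ∘ remQuot {suc n} m) ⟩
  List.tabulate (f ∘ remQuot {suc n} m ∘ (Fin._↑ˡ n * m)) ++
  List.tabulate (f ∘ remQuot {suc n} m ∘ (m Fin.↑ʳ_))
    ≡⟨ cong₂ _++_ (List.tabulate-cong (λ x → cong f (Fin.remQuot-combine {suc n} Fin.zero x)))
                  (List.tabulate-cong (λ y → cong f (remQuot-↑ʳ n m y))) ⟩
  List.tabulate (f ∘ (Fin.zero ,_)) ++
  List.tabulate (f ∘ Product.map₁ Fin.suc ∘ remQuot {n} m)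
    ≡⟨ cong₂ _++_ (sym (trans (cong (map f) (List.map-tabulate id (Fin.zero ,_)))
                              (List.map-tabulate (Fin.zero ,_) f)))
                  (tabulate-remQuot n m (f ∘ Product.map₁ Fin.suc)) ⟩
  map f (map (Fin.zero ,_) ms) ++ map (f ∘ Product.map₁ Fin.suc) (cartesianProduct (allFin n) ms)
    ≡⟨ cong (map f (map (Fin.zero ,_) ms) ++_) (trans
         (List.map-∘ (cartesianProduct (allFin n) ms))
         (cong (map f) (trans (sym (cartesianProduct-map₁ Fin.suc (allFin n) ms))
           (cong (λ xs → cartesianProduct xs ms) (List.map-tabulate id Fin.suc))))) ⟩
  map f (map (Fin.zero ,_) ms) ++ map f (cartesianProduct (List.tabulate Fin.suc) ms)
    ≡⟨ List.map-++ f (map (Fin.zero ,_) ms) _ ⟨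
  map f (map (Fin.zero ,_) ms ++ cartesianProduct (List.tabulate Fin.suc) ms) ∎
  where
  open ≡-Reasoning
  ms = allFin m

tabulate×′ : {m n : I → ℕ} {f : ∀ i → Fin (n i) × Fin (m i) → El (A i)} →
  Γ ⊢ (λ i → list (fin (n i) ⊠ fin (m i))) ∋ (λ i → cartesianProduct (allFin (n i)) (allFin (m i))) →
  Γ ▹ (λ i → fin (n i) ⊠ fin (m i)) ⊢ A ∘ proj₁ ∋ uncurry f →
  Γ ⊢ (λ i → vec (n i * m i) (A i)) ∋ (λ i → f i ∘ remQuot {n i} (m i))
tabulate×′ {A = A} {m = m} {n} {f} V F = recode
  (λ i → cong encodeList (trans (cong (map (enc (A i))) (sym (tabulate-remQuot (n i) (m i) (f i))))
    (List.map-tabulate (f i ∘ remQuot {n i} (m i)) (enc (A i)))))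
  (map′ F V)

combine′ : {m n : I → ℕ} {j : ∀ i → Fin (n i)} {l : ∀ i → Fin (m i)} →
  Γ ⊢ const nat ∋ m → Γ ⊢ (λ i → fin (n i)) ∋ j → Γ ⊢ (λ i → fin (m i)) ∋ l →
  Γ ⊢ (λ i → fin (n i * m i)) ∋ (λ i → combine (j i) (l i))
combine′ {j = j} {l} M J L = recode
  (λ i → cong encodeℕ (sym (Fin.toℕ-combine (j i) (l i))))
  ((M *′ toℕ′ J) +′ toℕ′ L)

-- Counting and matchings

module _ {A : Set} where

  count : (A → Bool) → List A → ℕ
  count p xs = length (filterᵇ p xs)

  count-∷ : ∀ (p : A → Bool) x xs → count p (x ∷ xs) ≡ (if p x then 1 else 0) + count p xs
  count-∷ p x xs with p x
  ... | true  = refl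
  ... | false = refl

  count-split : ∀ (p q : A → Bool) xs →
    count p xs ≡ count (λ x → p x ∧ q x) xs + count (λ x → p x ∧ not (q x)) xs
  count-split p q []       = refl
  count-split p q (x ∷ xs) with p x | q x
  ... | true  | true  = cong suc (count-split p q xs)
  ... | true  | false = trans (cong suc (count-split p q xs)) (sym (+-suc _ _))
  ... | false | _     = count-split p q xs

  count-mono : ∀ (p q : A → Bool) xs → (∀ x → x ∈ xs → T (p x) → T (q x)) → count p xs ≤ count q xs
  count-mono p q []       p⇒q = z≤n
  count-mono p q (x ∷ xs) p⇒q with p x | q x | p⇒q x (here refl) | count-mono p q xs (λ y → p⇒q y ∘ there)
  ... | true  | true  | _   | ih = s≤s ih
  ... | true  | false | px⇒ | _  = ⊥-elim (px⇒ _)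
  ... | false | true  | _   | ih = m≤n⇒m≤1+n ih
  ... | false | false | _   | ih = ih

  count-all : ∀ (p : A → Bool) xs → (∀ x → x ∈ xs → T (p x)) → count p xs ≡ length xs
  count-all p xs all = cong length (List.filter-all (T? ∘ p) (All.tabulate (λ {x} → all x)))

  -- Union bound: split off what the first class catches; the remainder is covered by the other
  -- classes.
  count-≤-cover : ∀ {C : Set} (cs : List C) (q : C → A → Bool) M (p : A → Bool) xs →
    (∀ x → T (p x) → ∃[ c ] c ∈ cs × T (q c x)) →
    (∀ c → c ∈ cs → count (q c) xs ≤ M) → count p xs ≤ length cs * M
  count-≤-cover []       q M p xs cover q≤ =
    ≤-reflexive (cong length (List.filter-none (T? ∘ p) {xs} (All.tabulate λ {x} _ px →
      case-∅ (cover x px))))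
    where
    case-∅ : ∀ {x} → ¬ (∃[ c ] c ∈ [] × T (q c x))
    case-∅ (_ , () , _)
  count-≤-cover (c ∷ cs) q M p xs cover q≤ = begin
    count p xs ≡⟨ count-split p (q c) xs ⟩
    count (λ x → p x ∧ q c x) xs + count (λ x → p x ∧ not (q c x)) xs
      ≤⟨ +-mono-≤
           (≤-trans (count-mono _ (q c) xs (λ x _ → proj₂ ∘ to T-∧)) (q≤ c (here refl)))
           (count-≤-cover cs q M (λ x → p x ∧ not (q c x)) xs cover′ (λ d → q≤ d ∘ there)) ⟩
    M + length cs * M ∎
    where
    open ≤-Reasoning
    cover′ : ∀ x → T (p x ∧ not (q c x)) → ∃[ d ] d ∈ cs × T (q d x)
    cover′ x px∧¬qx with to T-∧ px∧¬qx
    ... | px , ¬qx with cover x px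
    ... | d , there d∈cs , qx = d , d∈cs , qx
    ... | _ , here refl  , qx = ⊥-elim (subst T (to T-not-≡ ¬qx) qx)

  -- Remove one occurrence of the head from `ys`; by uniqueness the tail still lies in what is left.
  unique-⊆-length : ∀ {xs ys : List A} → Unique xs → (∀ {x} → x ∈ xs → x ∈ ys) →
                    length xs ≤ length ys
  unique-⊆-length {[]}     _        _  = z≤n
  unique-⊆-length {x ∷ xs} (x∉ ∷ u) ⊆ys with ∈-∃++ (⊆ys (here refl))
  ... | as , bs , refl = begin
    suc (length xs)          ≤⟨ s≤s (unique-⊆-length u ⊆rest) ⟩
    suc (length (as ++ bs))  ≡⟨ cong suc (List.length-++ as) ⟩
    suc (length as + length bs) ≡⟨ +-suc (length as) (length bs) ⟨
    length as + length (x ∷ bs) ≡⟨ List.length-++ as ⟨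
    length (as ++ x ∷ bs)    ∎
    where
    open ≤-Reasoning
    ⊆rest : ∀ {y} → y ∈ xs → y ∈ as ++ bs
    ⊆rest y∈xs with ∈-++⁻ as (⊆ys (there y∈xs))
    ... | inj₁ y∈as         = ∈-++⁺ˡ y∈as
    ... | inj₂ (there y∈bs) = ∈-++⁺ʳ as y∈bs
    ... | inj₂ (here refl)  = contradiction refl (All.lookup x∉ y∈xs)

  unique⇒allPairs : ∀ {R : A → A → Set} {xs} → Unique xs →
    (∀ {x y} → x ∈ xs → y ∈ xs → x ≢ y → R x y) → AllPairs R xs
  unique⇒allPairs []       _ = []
  unique⇒allPairs (x∉ ∷ u) r =
    All.tabulate (λ y∈ → r (here refl) (there y∈) (All.lookup x∉ y∈)) ∷
    unique⇒allPairs u (λ x∈ y∈ → r (there x∈) (there y∈))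

  ∈-sublists⇒⊆ : ∀ (xs : List A) {ys} → ys ∈ sublists xs → ∀ {y} → y ∈ ys → y ∈ xs
  ∈-sublists⇒⊆ []       (here refl) ()
  ∈-sublists⇒⊆ (x ∷ xs) ys∈ y∈ with ∈-++⁻ (map (x ∷_) (sublists xs)) ys∈
  ... | inj₂ ys∈′ = there (∈-sublists⇒⊆ xs ys∈′ y∈)
  ... | inj₁ ys∈′ with ∈-map⁻ (x ∷_) ys∈′
  ...   | zs , zs∈ , refl with y∈
  ...     | here refl = here refl
  ...     | there y∈zs = there (∈-sublists⇒⊆ xs zs∈ y∈zs)

  filter-∈-sublists : ∀ {P : A → Set} (P? : Decidable P) xs → filter P? xs ∈ sublists xs
  filter-∈-sublists P? []       = here refl
  filter-∈-sublists P? (x ∷ xs) with does (P? x)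
  ... | true  = ∈-++⁺ˡ (∈-map⁺ (x ∷_) (filter-∈-sublists P? xs))
  ... | false = ∈-++⁺ʳ (map (x ∷_) (sublists xs)) (filter-∈-sublists P? xs)

count-map : ∀ {A B : Set} (p : B → Bool) (f : A → B) xs → count p (map f xs) ≡ count (p ∘ f) xs
count-map p f []       = refl
count-map p f (x ∷ xs) with p (f x)
... | true  = cong suc (count-map p f xs)
... | false = count-map p f xs

count-++ : ∀ {A : Set} (p : A → Bool) xs ys → count p (xs ++ ys) ≡ count p xs + count p ys
count-++ p xs ys = trans (cong length (List.filter-++ (T? ∘ p) xs ys))
                         (List.length-++ (filterᵇ p xs))

module _ {A B : Set} (q : A × B → Bool) (h : A → Bool) (ys : List B) (m : ℕ) where

  private
    count-product-∷ : ∀ x xs → count q (cartesianProduct (x ∷ xs) ys) ≡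
      count (λ y → q (x , y)) ys + count q (cartesianProduct xs ys)
    count-product-∷ x xs = trans (count-++ q (map (x ,_) ys) (cartesianProduct xs ys))
      (cong (_+ count q (cartesianProduct xs ys)) (count-map q (x ,_) ys))

    *-count-∷ : ∀ x xs → m * count h (x ∷ xs) ≡ (if h x then m else 0) + m * count h xs
    *-count-∷ x xs with h x
    ... | true  = *-suc m (count h xs)
    ... | false = refl

  -- Counting fibre by fibre. In the application the fibre over a vertex consists of its copies; the
  -- reverse bound below serves the same purpose for whole blow-ups.
  count-product-≥ : (∀ x → T (h x) → m ≤ count (λ y → q (x , y)) ys) → ∀ xs →
    m * count h xs ≤ count q (cartesianProduct xs ys)
  count-product-≥ m≤ []       = ≤-reflexive (*-zeroʳ m)
  count-product-≥ m≤ (x ∷ xs) = begin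
    m * count h (x ∷ xs)                     ≡⟨ *-count-∷ x xs ⟩
    (if h x then m else 0) + m * count h xs  ≤⟨ +-mono-≤ (bound (h x) (m≤ x)) (count-product-≥ m≤ xs) ⟩
    count (λ y → q (x , y)) ys + count q (cartesianProduct xs ys) ≡⟨ count-product-∷ x xs ⟨
    count q (cartesianProduct (x ∷ xs) ys)   ∎
    where
    open ≤-Reasoning
    bound : ∀ b {l} → (T b → m ≤ l) → (if b then m else 0) ≤ l
    bound true  m≤l = m≤l _
    bound false _   = z≤n

  count-product-≤ : (∀ x → count (λ y → q (x , y)) ys ≤ (if h x then m else 0)) → ∀ xs →
    count q (cartesianProduct xs ys) ≤ m * count h xs
  count-product-≤ ≤m []       = z≤n
  count-product-≤ ≤m (x ∷ xs) = begin
    count q (cartesianProduct (x ∷ xs) ys)  ≡⟨ count-product-∷ x xs ⟩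
    count (λ y → q (x , y)) ys + count q (cartesianProduct xs ys)
      ≤⟨ +-mono-≤ (≤m x) (count-product-≤ ≤m xs) ⟩
    (if h x then m else 0) + m * count h xs ≡⟨ *-count-∷ x xs ⟨
    m * count h (x ∷ xs)                    ∎
    where open ≤-Reasoning

count-tabulate : ∀ {n} (p : Fin n → Bool) → ∣ Vec.tabulate p ∣ ≡ count p (allFin n)
count-tabulate {zero}  p = refl
count-tabulate {suc n} p = begin
  ∣ Vec.tabulate p ∣              ≡⟨ eq (p Fin.zero) (Vec.tabulate (p ∘ Fin.suc)) ⟩
  (if p Fin.zero then 1 else 0) + ∣ Vec.tabulate (p ∘ Fin.suc) ∣
    ≡⟨ cong ((if p Fin.zero then 1 else 0) +_) (count-tabulate (p ∘ Fin.suc)) ⟩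
  (if p Fin.zero then 1 else 0) + count (p ∘ Fin.suc) (allFin n)
    ≡⟨ cong ((if p Fin.zero then 1 else 0) +_) (trans (sym (count-map p Fin.suc (allFin n)))
         (cong (count p) (List.map-tabulate id Fin.suc))) ⟩
  (if p Fin.zero then 1 else 0) + count p (List.tabulate Fin.suc)
    ≡⟨ count-∷ p Fin.zero _ ⟨
  count p (allFin (suc n)) ∎
  where
  open ≡-Reasoning
  eq : ∀ {n} b (X : Subset n) → ∣ b Vec.∷ X ∣ ≡ (if b then 1 else 0) + ∣ X ∣
  eq true  X = refl
  eq false X = refl

∣∣≡count : ∀ {n} (X : Subset n) → ∣ X ∣ ≡ count (lookup X) (allFin n)
∣∣≡count X = trans (cong ∣_∣ (sym (Vec.tabulate∘lookup X))) (count-tabulate (lookup X))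

∈⇒T : ∀ {n} {X : Subset n} {x} → x Subset.∈ X → T (lookup X x)
∈⇒T x∈X = from T-≡ (Vec.[]=⇒lookup x∈X)

T⇒∈ : ∀ {n} {X : Subset n} {x} → T (lookup X x) → x Subset.∈ X
T⇒∈ {X = X} {x} Xx = Vec.lookup⇒[]= x X (to T-≡ Xx)

-- Upper and lower bounds on the rank

module _ (G : BipartiteGraph) where
  open BipartiteGraph G

  ∈-edgesAt⁻ : ∀ X {i j} → (i , j) ∈ edgesAt G X → i Subset.∈ X × T (adj i j)
  ∈-edgesAt⁻ X = proj₂ ∘ ∈-filter⁻ _ {xs = cartesianProduct (allFin a) (allFin b)}

  ∈-edgesAt⁺ : ∀ X {i j} → i Subset.∈ X → T (adj i j) → (i , j) ∈ edgesAt G X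
  ∈-edgesAt⁺ X {i} {j} i∈X ij =
    ∈-filter⁺ _ (∈-cartesianProduct⁺ (∈-allFin i) (∈-allFin j)) (i∈X , ij)

  -- The edges of a matching have distinct right ends, and all of these occur in `bs`.
  rank-≤ : ∀ X (bs : List (Fin b)) → (∀ {i j} → i Subset.∈ X → T (adj i j) → j ∈ bs) →
           rank G X ≤ length bs
  rank-≤ X bs ⊆bs = max≤v⁺ z≤n (All.tabulate λ l∈ →
    let M , M∈ , eq = ∈-map⁻ length l∈ in
    subst (_≤ length bs) (sym eq) (matching≤ M (∈-filter⁻ _ M∈)))
    where
    matching≤ : ∀ M → M ∈ sublists (edgesAt G X) × AllPairs (Disjoint G) M → length M ≤ length bs
    matching≤ M (M∈ , disjoint) = ≤-trans
      (≤-reflexive (sym (List.length-map proj₂ M)))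
      (unique-⊆-length (AllPairs.map⁺ (AllPairs.map proj₂ disjoint)) ⊆′)
      where
      ⊆′ : ∀ {j} → j ∈ map proj₂ M → j ∈ bs
      ⊆′ j∈ with ∈-map⁻ proj₂ j∈
      ... | (i , j) , ij∈M , refl =
        uncurry ⊆bs (∈-edgesAt⁻ X (∈-sublists⇒⊆ (edgesAt G X) M∈ ij∈M))

  -- The pairs `(φ j , j)` form a matching covering `bs`. Since the rank is a maximum over sublists
  -- of the edge list, the matching has to be realised as such a sublist, by filtering that list.
  rank-≥ : ∀ X (bs : List (Fin b)) (φ : Fin b → Fin a) → Unique bs →
    (∀ {j} → j ∈ bs → φ j Subset.∈ X × T (adj (φ j) j)) →
    (∀ {j j′} → j ∈ bs → j′ ∈ bs → φ j ≡ φ j′ → j ≡ j′) →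
    length bs ≤ rank G X
  rank-≥ X bs φ bs! valid injective = ≤-trans bs≤M
    (v≤max⁺ 0 _ (inj₂ (Any.map (λ eq → ≤-reflexive eq) (∈-map⁺ length M∈matchings))))
    where
    selected? : Decidable (λ (i , j) → j ∈ bs × i ≡ φ j)
    selected? (i , j) = Any.any? (j Fin.≟_) bs ×-dec (i Fin.≟ φ j)
    M = filter selected? (edgesAt G X)
    M! : Unique M
    M! = Unique.filter⁺ selected? (Unique.filter⁺ _
           (Unique.cartesianProduct⁺ (Unique.allFin⁺ a) (Unique.allFin⁺ b)))
    M-disjoint : ∀ {e f} → e ∈ M → f ∈ M → e ≢ f → Disjoint G e f
    M-disjoint {i , j} {i′ , j′} e∈ f∈ e≢f
      with ∈-filter⁻ selected? {xs = edgesAt G X} e∈ | ∈-filter⁻ selected? {xs = edgesAt G X} f∈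
    ... | _ , j∈ , refl | _ , j′∈ , refl =
      (λ eq → e≢f (cong (λ j → φ j , j) (injective j∈ j′∈ eq))) ,
      (λ eq → e≢f (cong (λ j → φ j , j) eq))
    M∈matchings : M ∈ matchings G X
    M∈matchings = ∈-filter⁺ (allPairs? (disjoint? G)) (filter-∈-sublists selected? (edgesAt G X))
      (unique⇒allPairs M! M-disjoint)
    bs≤M : length bs ≤ length M
    bs≤M = ≤-trans (≤-reflexive (sym (List.length-map (λ j → φ j , j) bs)))
      (unique-⊆-length (Unique.map⁺ (cong proj₂) bs!) ⊆M)
      where
      ⊆M : ∀ {e} → e ∈ map (λ j → φ j , j) bs → e ∈ M
      ⊆M e∈ with ∈-map⁻ (λ j → φ j , j) e∈
      ... | j , j∈ , refl = ∈-filter⁺ selected? (uncurry (∈-edgesAt⁺ X) (valid j∈)) (j∈ , refl)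

-- From dense subgraphs to rank reduction

pairs : ∀ n → List (Fin n × Fin n)
pairs n = cartesianProduct (allFin n) (allFin n)

-- The order test counts each undirected edge once. It is Boolean so that a program can evaluate it.
isEdge : ∀ {n} → (Fin n → Fin n → Bool) → Fin n × Fin n → Bool
isEdge adj (i , j) = (toℕ i <ᵇ toℕ j) ∧ adj i j

edges : ∀ {n} → (Fin n → Fin n → Bool) → ℕ
edges {n} adj = count (isEdge adj) (pairs n)

induced : ∀ {n} → (Fin n → Fin n → Bool) → (Fin n → Bool) → Fin n → Fin n → Bool
induced adj S i j = adj i j ∧ (S i ∧ S j)

card : ∀ {n} → (Fin n → Bool) → ℕ
card {n} S = count S (allFin n)

edgeCount≡edges : ∀ {n} (adj : Fin n → Fin n → Bool) → edgeCount adj ≡ edges adj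
edgeCount≡edges {n} adj = go (pairs n)
  where
  go : ∀ xs → length (filter (λ (i , j) → (i Fin.<? j) ×-dec T? (adj i j)) xs) ≡
              count (isEdge adj) xs
  go []             = refl
  go ((i , j) ∷ xs) with isEdge adj (i , j)
  ... | true  = cong suc (go xs)
  ... | false = go xs

incident : ∀ {n m} → (Fin n → Fin n → Bool) → Fin n × Fin m → Fin n × Fin n → Bool
incident adj (v , _) (i , j) =
  isEdge adj (i , j) ∧ ((toℕ v ≡ᵇ toℕ i) ∨ (toℕ v ≡ᵇ toℕ j))

-- Every vertex is represented by 2n elements, each adjacent to all edges at
-- that vertex; pairs of vertices that are not edges are isolated.
incidenceModel : ∀ {n} → (Fin n → Fin n → Bool) → BipartiteGraph
incidenceModel {n} adj = record
  { a   = n * (n + n)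
  ; b   = n * n
  ; adj = λ x y → incident adj (remQuot {n} (n + n) x) (remQuot {n} n y)
  }

module _ {n : ℕ} (adj : Fin n → Fin n → Bool) where

  private
    N = n + n
    G = incidenceModel adj

  open BipartiteGraph G using (a)

  inside outside : (Fin n → Bool) → ℕ
  inside  U = edges (induced adj U)
  outside U = count (λ e → isEdge adj e ∧ not (U (proj₁ e) ∧ U (proj₂ e))) (pairs n)

  inside+outside : ∀ U → edges adj ≡ inside U + outside U
  inside+outside U = trans (count-split (isEdge adj) (λ e → U (proj₁ e) ∧ U (proj₂ e)) (pairs n))
    (cong (_+ outside U) (≤-antisym
      (count-mono _ _ (pairs n) λ (i , j) _ → assocʳ {toℕ i <ᵇ toℕ j})
      (count-mono _ _ (pairs n) λ (i , j) _ → assocˡ {toℕ i <ᵇ toℕ j})))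
    where
    assocʳ : ∀ {x y z} → T ((x ∧ y) ∧ z) → T (x ∧ (y ∧ z))
    assocʳ {true} t = t
    assocˡ : ∀ {x y z} → T (x ∧ (y ∧ z)) → T ((x ∧ y) ∧ z)
    assocˡ {true} t = t

  copies : Subset a → Fin n → ℕ
  copies X v = count (λ c → lookup X (combine v c)) (allFin N)

  private
    ∣∣≡count-pairs : ∀ X → ∣ X ∣ ≡ count (λ (v , c) → lookup X (combine v c))
                                         (cartesianProduct (allFin n) (allFin N))
    ∣∣≡count-pairs X = begin
      ∣ X ∣                        ≡⟨ ∣∣≡count X ⟩
      count (lookup X) (allFin a)
        ≡⟨ cong (count (lookup X)) (List.tabulate-cong (λ x → sym (Fin.combine-remQuot {n} N x))) ⟩
      count (lookup X) (List.tabulate (uncurry combine ∘ remQuot {n} N))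
        ≡⟨ cong (count (lookup X)) (tabulate-remQuot n N (uncurry combine)) ⟩
      count (lookup X) (map (uncurry combine) (cartesianProduct (allFin n) (allFin N)))
        ≡⟨ count-map (lookup X) (uncurry combine) (cartesianProduct (allFin n) (allFin N)) ⟩
      count (lookup X ∘ uncurry combine) (cartesianProduct (allFin n) (allFin N)) ∎
      where open ≡-Reasoning

  heavy : Subset a → Fin n → Bool
  heavy X v = not (copies X v <ᵇ n)

  heavy-card : ∀ X → n * card (heavy X) ≤ ∣ X ∣
  heavy-card X = ≤-trans
    (count-product-≥ _ (heavy X) (allFin N) n
      (λ v hv → ≮⇒≥ (λ lt → subst T (to T-not-≡ hv) (<⇒<ᵇ lt))) (allFin n))
    (≤-reflexive (sym (∣∣≡count-pairs X)))

  blowup : (Fin n → Bool) → Subset a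
  blowup W = Vec.tabulate (λ x → W (proj₁ (remQuot {n} N x)))

  lookup-blowup : ∀ W x → lookup (blowup W) x ≡ W (proj₁ (remQuot {n} N x))
  lookup-blowup W = Vec.lookup∘tabulate _

  blowup-card : ∀ W → ∣ blowup W ∣ ≤ N * card W
  blowup-card W = ≤-trans (≤-reflexive (∣∣≡count-pairs (blowup W)))
    (count-product-≤ _ W (allFin N) N fibre≤ (allFin n))
    where
    fibre≤ : ∀ v → count (λ c → lookup (blowup W) (combine v c)) (allFin N) ≤ (if W v then N else 0)
    fibre≤ v with W v in eq
    ... | true  = ≤-trans (List.length-filter _ (allFin N)) (≤-reflexive (List.length-tabulate {n = N} id))
    ... | false = ≤-reflexive (cong length (List.filter-none
      (T? ∘ (λ c → lookup (blowup W) (combine v c))) {allFin N}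
      (All.tabulate λ {c} _ t → subst T (trans (lookup-blowup W (combine v c))
        (trans (cong (W ∘ proj₁) (Fin.remQuot-combine v c)) eq)) t)))

  private
    columns : (Fin n × Fin n → Bool) → List (Fin (n * n))
    columns p = map (uncurry combine) (filterᵇ p (pairs n))

    length-columns : ∀ p → length (columns p) ≡ count p (pairs n)
    length-columns p = List.length-map (uncurry combine) (filterᵇ p (pairs n))

    ∈-columns⁺ : ∀ p y → T (p (remQuot {n} n y)) → y ∈ columns p
    ∈-columns⁺ p y py = subst (_∈ columns p) (Fin.combine-remQuot {n} n y)
      (∈-map⁺ (uncurry combine) (∈-filter⁺ (T? ∘ p)
        (∈-cartesianProduct⁺ (∈-allFin _) (∈-allFin _)) py))

    ∈-columns⁻ : ∀ p {y} → y ∈ columns p → T (p (remQuot {n} n y))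
    ∈-columns⁻ p y∈ with ∈-map⁻ (uncurry combine) y∈
    ... | (i , j) , e∈ , refl = subst (T ∘ p) (sym (Fin.remQuot-combine i j))
      (proj₂ (∈-filter⁻ (T? ∘ p) {xs = pairs n} e∈))

    columns! : ∀ p → Unique (columns p)
    columns! p = Unique.map⁺ (λ {e} {f} eq → cong₂ _,_
        (Fin.combine-injectiveˡ (proj₁ e) (proj₂ e) (proj₁ f) (proj₂ f) eq)
        (Fin.combine-injectiveʳ (proj₁ e) (proj₂ e) (proj₁ f) (proj₂ f) eq))
      (Unique.filter⁺ (T? ∘ p) (Unique.cartesianProduct⁺ (Unique.allFin⁺ n) (Unique.allFin⁺ n)))

  rank≤edges : ∀ Y → rank G Y ≤ edges adj
  rank≤edges Y = ≤-trans (rank-≤ G Y (columns (isEdge adj))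
      (λ {x} {y} _ xy → ∈-columns⁺ (isEdge adj) y (proj₁ (to T-∧ xy))))
    (≤-reflexive (length-columns (isEdge adj)))

  -- The elements left are copies of vertices outside `W`, so every column they reach is an edge
  -- with an end outside `W`.
  rank-blowup : ∀ W → rank G (∁ (blowup W)) ≤ outside W
  rank-blowup W = ≤-trans (rank-≤ G (∁ (blowup W)) (columns p) (λ {x} {y} → member x y))
    (≤-reflexive (length-columns p))
    where
    p : Fin n × Fin n → Bool
    p e = isEdge adj e ∧ not (W (proj₁ e) ∧ W (proj₂ e))
    member : ∀ x y → x Subset.∈ ∁ (blowup W) →
      T (incident adj (remQuot {n} N x) (remQuot {n} n y)) → y ∈ columns p
    member x y x∈ xy = ∈-columns⁺ p y (from T-∧ (proj₁ (to T-∧ xy) , notBoth))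
      where
      v = proj₁ (remQuot {n} N x)
      i = proj₁ (remQuot {n} n y)
      j = proj₂ (remQuot {n} n y)
      Wv : T (not (W v))
      Wv = subst T (trans (Vec.lookup-map x not (blowup W)) (cong not (lookup-blowup W x))) (∈⇒T x∈)
      not-∧ˡ : ∀ {b c} → T (not b) → T (not (b ∧ c))
      not-∧ˡ {false} _ = _
      not-∧ʳ : ∀ {b c} → T (not c) → T (not (b ∧ c))
      not-∧ʳ {true}  t = t
      not-∧ʳ {false} _ = _
      ≡ᵇ⇒≡′ : ∀ {u w : Fin n} → T (toℕ u ≡ᵇ toℕ w) → u ≡ w
      ≡ᵇ⇒≡′ t = Fin.toℕ-injective (≡ᵇ⇒≡ _ _ t)
      notBoth : T (not (W i ∧ W j))
      notBoth with to T-∨ (proj₂ (to (T-∧ {isEdge adj (i , j)}) xy))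
      ... | inj₁ v≡i = not-∧ˡ (subst (T ∘ not ∘ W) (≡ᵇ⇒≡′ v≡i) Wv)
      ... | inj₂ v≡j = not-∧ʳ {W i} (subst (T ∘ not ∘ W) (≡ᵇ⇒≡′ v≡j) Wv)

  -- Each edge not inside U has an end v outside U; match it to the copy of v
  -- in Y that is indexed by its other end.
  outside≤rank : ∀ U Y → (∀ v → U v ≡ false → n ≤ copies Y v) → outside U ≤ rank G Y
  outside≤rank U Y enough = ≤-trans (≤-reflexive (sym (length-columns p)))
    (rank-≥ G Y (columns p) φ (columns! p) (valid ∘ ∈-columns⁻ p)
      (λ y∈ y′∈ → injective (∈-columns⁻ p y∈) (∈-columns⁻ p y′∈)))
    where
    p : Fin n × Fin n → Bool
    p e = isEdge adj e ∧ not (U (proj₁ e) ∧ U (proj₂ e))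

    available : Fin n → List (Fin N)
    available v = filterᵇ (λ c → lookup Y (combine v c)) (allFin N)

    copy : Fin n → Fin n → Fin N
    copy v w with toℕ w <? length (available v)
    ... | yes w<l = List.lookup (available v) (fromℕ< w<l)
    -- A default that makes `copy` total. For `v` outside `U` it does not occur, as at least `n`
    -- copies are available and `w` has index below `n`.
    ... | no  _   = w ↑ˡ n

    copy∈available : ∀ v w → U v ≡ false → copy v w ∈ available v
    copy∈available v w Uv with toℕ w <? length (available v)
    ... | yes w<l = ∈-lookup (fromℕ< w<l)
    ... | no  w≮l = contradiction (<-≤-trans (Fin.toℕ<n w) (enough v Uv)) w≮l

    lookup-injective : ∀ {A : Set} {xs : List A} → Unique xs → ∀ i j →
      List.lookup xs i ≡ List.lookup xs j → i ≡ j
    lookup-injective (x∉ ∷ u) Fin.zero    Fin.zero    eq = refl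
    lookup-injective (x∉ ∷ u) Fin.zero    (Fin.suc j) eq = contradiction eq (All.lookup x∉ (∈-lookup j))
    lookup-injective (x∉ ∷ u) (Fin.suc i) Fin.zero    eq = contradiction (sym eq) (All.lookup x∉ (∈-lookup i))
    lookup-injective (x∉ ∷ u) (Fin.suc i) (Fin.suc j) eq = cong Fin.suc (lookup-injective u i j eq)

    copy-injective : ∀ v w w′ → U v ≡ false → copy v w ≡ copy v w′ → w ≡ w′
    copy-injective v w w′ Uv eq with toℕ w <? length (available v) | toℕ w′ <? length (available v)
    ... | yes w<l | yes w′<l = Fin.toℕ-injective (trans (sym (Fin.toℕ-fromℕ< w<l)) (trans
      (cong toℕ (lookup-injective (Unique.filter⁺ _ (Unique.allFin⁺ N)) _ _ eq)) (Fin.toℕ-fromℕ< w′<l)))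
    ... | no w≮l  | _        = contradiction (<-≤-trans (Fin.toℕ<n w) (enough v Uv)) w≮l
    ... | yes _   | no w′≮l  = contradiction (<-≤-trans (Fin.toℕ<n w′) (enough v Uv)) w′≮l

    -- Puts an end outside `U` first: if `i` lies in `U`, then `j` cannot, for an edge not inside
    -- `U`.
    orient : Fin n × Fin n → Fin n × Fin n
    orient (i , j) = if U i then (j , i) else (i , j)

    φ : Fin (n * n) → Fin a
    φ y = let v , w = orient (remQuot {n} n y) in combine v (copy v w)

    orient-free : ∀ e → T (not (U (proj₁ e) ∧ U (proj₂ e))) → U (proj₁ (orient e)) ≡ false
    orient-free (i , j) t with U i in eq
    ... | true  = to T-not-≡ t
    ... | false = eq

    orient-end : ∀ e → T ((toℕ (proj₁ (orient e)) ≡ᵇ toℕ (proj₁ e)) ∨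
                          (toℕ (proj₁ (orient e)) ≡ᵇ toℕ (proj₂ e)))
    orient-end (i , j) with U i
    ... | true  = from (T-∨ {toℕ j ≡ᵇ toℕ i}) (inj₂ (≡⇒≡ᵇ (toℕ j) (toℕ j) refl))
    ... | false = from T-∨ (inj₁ (≡⇒≡ᵇ (toℕ i) (toℕ i) refl))

    -- Two edges oriented in opposite ways onto the same ordered pair would be reverses of each
    -- other, which the order of the ends of an edge forbids.
    orient-injective : ∀ e f → T (isEdge adj e) → T (isEdge adj f) → orient e ≡ orient f → e ≡ f
    orient-injective (i , j) (i′ , j′) e-edge f-edge eq
      with U i | U i′ | <ᵇ⇒< (toℕ i) (toℕ j) (proj₁ (to T-∧ e-edge))
         | <ᵇ⇒< (toℕ i′) (toℕ j′) (proj₁ (to T-∧ f-edge)) | eq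
    ... | true  | true  | _   | _     | refl = refl
    ... | false | false | _   | _     | refl = refl
    ... | true  | false | i<j | i′<j′ | refl = contradiction i<j (<-asym i′<j′)
    ... | false | true  | i<j | i′<j′ | refl = contradiction i<j (<-asym i′<j′)

    valid : ∀ {y} → T (p (remQuot {n} n y)) → φ y Subset.∈ Y ×
            T (incident adj (remQuot {n} N (φ y)) (remQuot {n} n y))
    valid {y} py =
      T⇒∈ (proj₂ (∈-filter⁻ (λ c → T? (lookup Y (combine v c))) {xs = allFin N}
        (copy∈available v w (orient-free e (proj₂ (to (T-∧ {isEdge adj e}) py))))))
      , subst (λ x → T (incident adj x e)) (sym (Fin.remQuot-combine v (copy v w)))
          (from T-∧ (proj₁ (to T-∧ py) , orient-end e))
      where
      e = remQuot {n} n y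
      v = proj₁ (orient e)
      w = proj₂ (orient e)

    injective : ∀ {y y′} → T (p (remQuot {n} n y)) → T (p (remQuot {n} n y′)) →
                φ y ≡ φ y′ → y ≡ y′
    injective {y} {y′} py py′ eq = begin
      y                          ≡⟨ Fin.combine-remQuot {n} n y ⟨
      uncurry combine e          ≡⟨ cong (uncurry combine) (orient-injective e e′
        (proj₁ (to T-∧ py)) (proj₁ (to T-∧ py′)) (cong₂ _,_ v≡v′ w≡w′)) ⟩
      uncurry combine e′         ≡⟨ Fin.combine-remQuot {n} n y′ ⟩
      y′                         ∎
      where
      open ≡-Reasoning
      e  = remQuot {n} n y
      e′ = remQuot {n} n y′
      v  = proj₁ (orient e)
      v′ = proj₁ (orient e′)
      w  = proj₂ (orient e)
      w′ = proj₂ (orient e′)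
      v≡v′ : v ≡ v′
      v≡v′ = Fin.combine-injectiveˡ v (copy v w) v′ (copy v′ w′) eq
      w≡w′ : w ≡ w′
      w≡w′ = copy-injective v w w′ (orient-free e (proj₂ (to (T-∧ {isEdge adj e}) py)))
        (trans (Fin.combine-injectiveʳ v (copy v w) v′ (copy v′ w′) eq)
          (cong (λ u → copy u w′) (sym v≡v′)))

  private
    copies-∁ : ∀ X v → N ≡ copies X v + copies (∁ X) v
    copies-∁ X v = begin
      N                    ≡⟨ List.length-tabulate {n = N} id ⟨
      length (allFin N)    ≡⟨ count-all (const true) (allFin N) (λ _ _ → _) ⟨
      count (const true) (allFin N)
        ≡⟨ count-split (const true) (λ c → lookup X (combine v c)) (allFin N) ⟩
      copies X v + count (λ c → not (lookup X (combine v c))) (allFin N)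
        ≡⟨ cong (λ l → copies X v + length l) (List.filter-≐ _ _
             ((λ {c} → subst T (sym (Vec.lookup-map (combine v c) not X))) ,
              (λ {c} → subst T (Vec.lookup-map (combine v c) not X))) (allFin N)) ⟩
      copies X v + copies (∁ X) v ∎
      where open ≡-Reasoning

  feasible⇒inside : ∀ X p → rank G (∁ X) + p ≤ rank G ⊤ → p ≤ inside (heavy X)
  feasible⇒inside X p feasible = +-cancelʳ-≤ (outside U) p (inside U) (begin
    p + outside U        ≡⟨ +-comm p (outside U) ⟩
    outside U + p        ≤⟨ +-monoˡ-≤ p (outside≤rank U (∁ X) enough) ⟩
    rank G (∁ X) + p     ≤⟨ feasible ⟩
    rank G ⊤             ≤⟨ rank≤edges ⊤ ⟩
    edges adj            ≡⟨ inside+outside U ⟩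
    inside U + outside U ∎)
    where
    open ≤-Reasoning
    U = heavy X
    enough : ∀ v → U v ≡ false → n ≤ copies (∁ X) v
    -- Of `n + n` copies a light vertex loses fewer than `n`.
    enough v Uv = +-cancelˡ-≤ (copies X v) n (copies (∁ X) v) (≤-trans
      (+-monoˡ-≤ n (<⇒≤ (<ᵇ⇒< (copies X v) n (light (copies X v <ᵇ n) Uv)))) (≤-reflexive (copies-∁ X v)))
      where
      light : ∀ b → not b ≡ false → T b
      light true _ = _

  inside⇒feasible : ∀ W p → p ≤ inside W → rank G (∁ (blowup W)) + p ≤ rank G ⊤
  inside⇒feasible W p p≤ = begin
    rank G (∁ (blowup W)) + p ≤⟨ +-mono-≤ (rank-blowup W) p≤ ⟩
    outside W + inside W      ≡⟨ +-comm (outside W) (inside W) ⟩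
    inside W + outside W      ≡⟨ inside+outside W ⟨
    edges adj                 ≤⟨ count-mono _ _ (pairs n) (λ e _ t → from T-∧ (t , _)) ⟩
    -- With the empty set for `U` every edge is outside, so the full rank is at least the number of
    -- edges.
    outside (const false)     ≤⟨ outside≤rank (const false) ⊤ enough ⟩
    rank G ⊤                  ∎
    where
    open ≤-Reasoning
    enough : ∀ v → false ≡ false → n ≤ copies ⊤ v
    enough v _ = ≤-trans (m≤m+n n n) (≤-reflexive (sym (trans
      (count-all _ (allFin N) (λ c _ → subst T (sym (Vec.lookup-replicate (combine v c) true)) _))
      (List.length-tabulate {n = N} id))))

-- Extracting a set of size k from a larger set

insert : ∀ {n} → (Fin n → Bool) → Fin n → Fin n → Bool
insert S v j = S j ∨ (toℕ j ≡ᵇ toℕ v)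

-- Inserting a vertex that is already present leaves the cardinality unchanged, so repetitions in
-- the list use up no room. The same function truncates a list to `c` vertices and pads a set up to
-- `c`.
fill : ∀ {n} → ℕ → (Fin n → Bool) → List (Fin n) → Fin n → Bool
fill c = foldl (λ S v → if card S <ᵇ c then insert S v else S)

insert-∈ : ∀ {n} (S : Fin n → Bool) v → T (insert S v v)
insert-∈ S v = from (T-∨ {S v}) (inj₂ (≡⇒≡ᵇ (toℕ v) (toℕ v) refl))

insert-⊇ : ∀ {n} (S : Fin n → Bool) v j → T (S j) → T (insert S v j)
insert-⊇ S v j = from T-∨ ∘ inj₁

card-insert : ∀ {n} (S : Fin n → Bool) v → card (insert S v) ≤ suc (card S)
card-insert {n} S v = unique-⊆-length {ys = v ∷ filterᵇ S (allFin n)}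
  (Unique.filter⁺ _ (Unique.allFin⁺ n)) ⊆′
  where
  ⊆′ : ∀ {j} → j ∈ filterᵇ (insert S v) (allFin n) → j ∈ v ∷ filterᵇ S (allFin n)
  ⊆′ {j} j∈ with to T-∨ (proj₂ (∈-filter⁻ (T? ∘ insert S v) {xs = allFin n} j∈))
  ... | inj₁ Sj  = there (∈-filter⁺ (T? ∘ S) (∈-allFin j) Sj)
  ... | inj₂ j≡v = here (Fin.toℕ-injective (≡ᵇ⇒≡ (toℕ j) (toℕ v) j≡v))

card-mono : ∀ {n} (S S′ : Fin n → Bool) → (∀ j → T (S j) → T (S′ j)) → card S ≤ card S′
card-mono {n} S S′ S⊆S′ = count-mono S S′ (allFin n) (λ j _ → S⊆S′ j)

card-∅ : ∀ n → card {n} (const false) ≡ 0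
card-∅ n = cong length (List.filter-none (T? ∘ const false) {allFin n} (All.tabulate (λ _ ())))

fill-⊇ : ∀ {n} c l (S : Fin n → Bool) j → T (S j) → T (fill c S l j)
fill-⊇ c []      S j Sj = Sj
fill-⊇ c (v ∷ l) S j Sj with card S <ᵇ c
... | true  = fill-⊇ c l (insert S v) j (insert-⊇ S v j Sj)
... | false = fill-⊇ c l S j Sj

fill-card-≤ : ∀ {n} c l (S : Fin n → Bool) → card S ≤ c → card (fill c S l) ≤ c
fill-card-≤ c []      S S≤c = S≤c
fill-card-≤ c (v ∷ l) S S≤c with card S <ᵇ c in eq
... | true  = fill-card-≤ c l (insert S v) (≤-trans (card-insert S v) (<ᵇ⇒< (card S) c (from T-≡ eq)))
... | false = fill-card-≤ c l S S≤c

-- Each insertion raises the cardinality by at most one, so the first `m` entries all arrive while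
-- there is room.
fill-take : ∀ {n} c l (S : Fin n → Bool) m → card S + m ≤ c →
  ∀ {j} → j ∈ take m l → T (fill c S l j)
fill-take c (v ∷ l) S (suc m) S+m≤c j∈ with card S <ᵇ c in eq | j∈
... | false | _         = ⊥-elim (subst T eq (<⇒<ᵇ (<-≤-trans (m<m+n (card S) z<s) S+m≤c)))
... | true  | here refl = fill-⊇ c l (insert S v) v (insert-∈ S v)
... | true  | there j∈′ = fill-take c l (insert S v) m
  (≤-trans (+-monoˡ-≤ m (card-insert S v))
    (≤-trans (≤-reflexive (sym (+-suc (card S) m))) S+m≤c)) j∈′

fill-full : ∀ {n} c l (S : Fin n → Bool) →
  c ≤ card (fill c S l) ⊎ (∀ {j} → j ∈ l → T (fill c S l j))
fill-full c []      S = inj₂ (λ ())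
fill-full c (v ∷ l) S with card S <ᵇ c in eq
... | false = inj₁ (≤-trans (≮⇒≥ (λ lt → subst T eq (<⇒<ᵇ lt)))
                           (card-mono S (fill c S l) (fill-⊇ c l S)))
... | true  with fill-full c l (insert S v)
...   | inj₁ c≤ = inj₁ c≤
...   | inj₂ ⊆  = inj₂ λ { (here refl) → fill-⊇ c l (insert S v) v (insert-∈ S v)
                           ; (there j∈)  → ⊆ j∈ }

-- If `c` were not reached, every entry would have been inserted, hence all `n` vertices, and `c` is
-- at most `n`.
fill-card : ∀ {n} c l (S : Fin n → Bool) → card S ≤ c → c ≤ n → (∀ j → j ∈ l) →
  card (fill c S l) ≡ c
fill-card {n} c l S S≤c c≤n all = ≤-antisym (fill-card-≤ c l S S≤c)
  ([ id , (λ ⊆ → ≤-trans c≤n (≤-reflexive (trans (sym (List.length-tabulate {n = n} id))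
    (sym (count-all _ (allFin n) (λ j _ → ⊆ (all j))))))) ]′ (fill-full c l S))

-- The cap `h` on the first list leaves room for `h` entries of the second when `h + h ≤ k`; the
-- final `allFin n` pads to exactly `k` vertices.
windows : ∀ {n} → ℕ → ℕ → List (Fin n) → List (Fin n) → Fin n → Bool
windows {n} k h l l′ = fill k (fill h (const false) l) (l′ ++ allFin n)

module _ {n k h : ℕ} (l l′ : List (Fin n)) where

  windows-card : h ≤ k → k ≤ n → card (windows k h l l′) ≡ k
  windows-card h≤k k≤n = fill-card k (l′ ++ allFin n) (fill h (const false) l)
    (≤-trans (fill-card-≤ h l (const false) (≤-trans (≤-reflexive (card-∅ n)) z≤n)) h≤k) k≤n
    (λ j → ∈-++⁺ʳ l′ (∈-allFin j))

  ∈-windowsˡ : ∀ {j} → j ∈ take h l → T (windows k h l l′ j)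
  ∈-windowsˡ {j} j∈ = fill-⊇ k (l′ ++ allFin n) (fill h (const false) l) j
    (fill-take h l (const false) h (≤-reflexive (cong (_+ h) (card-∅ n))) j∈)

  ∈-windowsʳ : h + h ≤ k → ∀ {j} → j ∈ take h l′ → T (windows k h l l′ j)
  ∈-windowsʳ 2h≤k j∈ = fill-take k (l′ ++ allFin n) (fill h (const false) l) h
    (≤-trans (+-monoˡ-≤ h (fill-card-≤ h l (const false) (≤-trans (≤-reflexive (card-∅ n)) z≤n))) 2h≤k)
    (take-++ h l′ j∈)
    where
    take-++ : ∀ m (xs : List (Fin n)) {ys j} → j ∈ take m xs → j ∈ take m (xs ++ ys)
    take-++ (suc m) (x ∷ xs) (here eq)  = here eq
    take-++ (suc m) (x ∷ xs) (there j∈) = there (take-++ m xs j∈)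

∈-block : ∀ {A : Set} {x : A} h b l → x ∈ l → length l ≤ b * h →
          ∃[ a ] a < b × x ∈ take h (drop (a * h) l)
∈-block h zero    (_ ∷ _) _  ()
∈-block h (suc b) l x∈ l≤ with ∈-++⁻ (take h l) (subst (_ ∈_) (sym (List.take++drop≡id h l)) x∈)
... | inj₁ x∈take = 0 , z<s , x∈take
... | inj₂ x∈drop with ∈-block h b (drop h l) x∈drop
        (≤-trans (≤-reflexive (List.length-drop h l)) (m≤n+o⇒m∸n≤o (length l) h l≤))
...   | a , a<b , x∈ =
  suc a , s<s a<b , subst (λ l′ → _ ∈ take h l′) (List.drop-drop h (a * h) l) x∈

-- The algorithm tries offsets up to `n` only. A block that starts beyond the end of the list is
-- empty, so capping its offset at `n` loses nothing.
drop-⊓ : ∀ {A : Set} m n (l : List A) → length l ≤ n → drop (m ⊓ n) l ≡ drop m l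
drop-⊓ m n l l≤n with ≤-total m n
... | inj₁ m≤n = cong (λ o → drop o l) (m≤n⇒m⊓n≡m m≤n)
... | inj₂ n≤m = trans (cong (λ o → drop o l) (m≥n⇒m⊓n≡n n≤m))
  (trans (List.drop-all n l l≤n) (sym (List.drop-all m l (≤-trans l≤n n≤m))))

-- Cut U into b blocks of size h: each edge inside U lies in one of the b²
-- unions of two blocks, and each of these is contained in a set of size k.
inside≤blocks : ∀ {n} (adj : Fin n → Fin n → Bool) U k h b M → h + h ≤ k → card U ≤ b * h →
  (∀ {s t} → s ≤ n → t ≤ n →
    inside adj (windows k h (drop s (filterᵇ U (allFin n))) (drop t (filterᵇ U (allFin n)))) ≤ M) →
  inside adj U ≤ b * b * M
inside≤blocks {n} adj U k h b M 2h≤k U≤ M-bound = ≤-trans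
  (count-≤-cover (cartesianProduct (upTo b) (upTo b)) q M (isEdge (induced adj U)) (pairs n) cover
    (λ (s , t) _ → M-bound (m⊓n≤n (s * h) n) (m⊓n≤n (t * h) n)))
  (≤-reflexive (cong (_* M) (trans (length-cartesianProduct (upTo b) (upTo b))
    (cong₂ _*_ (List.length-upTo b) (List.length-upTo b)))))
  where
  l = filterᵇ U (allFin n)
  block : ℕ → List (Fin n)
  block s = drop (s * h ⊓ n) l
  q : ℕ × ℕ → Fin n × Fin n → Bool
  q (s , t) = isEdge (induced adj (windows k h (block s) (block t)))
  l≤n : length l ≤ n
  l≤n = ≤-trans (List.length-filter _ (allFin n)) (≤-reflexive (List.length-tabulate {n = n} id))
  member : ∀ v → T (U v) → ∃[ s ] s < b × v ∈ take h (block s)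
  member v Uv with ∈-block h b l (∈-filter⁺ (T? ∘ U) (∈-allFin v) Uv) U≤
  ... | s , s<b , v∈ = s , s<b , subst (λ l′ → v ∈ take h l′) (sym (drop-⊓ (s * h) n l l≤n)) v∈
  cover : ∀ e → T (isEdge (induced adj U) e) →
          ∃[ c ] c ∈ cartesianProduct (upTo b) (upTo b) × T (q c e)
  cover (i , j) t with to (T-∧ {toℕ i <ᵇ toℕ j}) t
  ... | i<j , t′ with to (T-∧ {adj i j}) t′
  ...   | ij , UU with to T-∧ UU
  ...     | Ui , Uj with member i Ui | member j Uj
  ...       | s , s<b , i∈ | s′ , s′<b , j∈ =
    (s , s′) , ∈-cartesianProduct⁺ (∈-upTo⁺ s<b) (∈-upTo⁺ s′<b) ,
    from T-∧ (i<j , from (T-∧ {adj i j}) (ij , from T-∧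
      (∈-windowsˡ {k = k} {h} (block s) (block s′) i∈ ,
       ∈-windowsʳ {k = k} {h} (block s) (block s′) 2h≤k j∈)))

-- A positive optimum thus forces `k` to be at least 2, so that the block size `⌊ k /2⌋` is
-- positive.
edge⇒2≤card : ∀ {n} (adj : Fin n → Fin n → Bool) S → 0 < inside adj S → 2 ≤ card S
edge⇒2≤card {n} adj S 0<e with filterᵇ (isEdge (induced adj S)) (pairs n) in eq | 0<e
... | (i , j) ∷ _ | _ = unique-⊆-length {xs = i ∷ j ∷ []} ((i≢j ∷ []) ∷ [] ∷ []) ⊆′
  where
  ij : T (isEdge (induced adj S) (i , j))
  ij = proj₂ (∈-filter⁻ (T? ∘ isEdge (induced adj S)) {xs = pairs n}
    (subst ((i , j) ∈_) (sym eq) (here refl)))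
  i≢j : i ≢ j
  i≢j refl = <-irrefl refl (<ᵇ⇒< (toℕ i) (toℕ i) (proj₁ (to T-∧ ij)))
  SS : T (S i ∧ S j)
  SS = proj₂ (to (T-∧ {adj i j}) (proj₂ (to (T-∧ {toℕ i <ᵇ toℕ j}) ij)))
  ⊆′ : ∀ {v} → v ∈ i ∷ j ∷ [] → v ∈ filterᵇ S (allFin n)
  ⊆′ (here refl)         = ∈-filter⁺ (T? ∘ S) (∈-allFin i) (proj₁ (to T-∧ SS))
  ⊆′ (there (here refl)) = ∈-filter⁺ (T? ∘ S) (∈-allFin j) (proj₂ (to (T-∧ {S i}) SS))

-- Selecting a best candidate

module _ {A : Set} (f : A → ℕ) where

  best : A → List A → A
  best = foldl (λ x y → if f x <ᵇ f y then y else x)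

  best-≥-init : ∀ z xs → f z ≤ f (best z xs)
  best-≥-init z []       = ≤-refl
  best-≥-init z (x ∷ xs) with f z <ᵇ f x in eq
  ... | true  = ≤-trans (<⇒≤ (<ᵇ⇒< (f z) (f x) (from T-≡ eq))) (best-≥-init x xs)
  ... | false = best-≥-init z xs

  best-≥ : ∀ z xs {x} → x ∈ xs → f x ≤ f (best z xs)
  best-≥ z (y ∷ xs) (there x∈)  = best-≥ (if f z <ᵇ f y then y else z) xs x∈
  best-≥ z (x ∷ xs) (here refl) with f z <ᵇ f x in eq
  ... | true  = best-≥-init x xs
  ... | false = ≤-trans (≮⇒≥ (λ lt → subst T eq (<⇒<ᵇ lt))) (best-≥-init z xs)

  best-preserves : ∀ {P : A → Set} z xs → P z → (∀ {x} → x ∈ xs → P x) → P (best z xs)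
  best-preserves z []       Pz Pxs = Pz
  best-preserves z (x ∷ xs) Pz Pxs with f z <ᵇ f x
  ... | true  = best-preserves x xs (Pxs (here refl)) (Pxs ∘ there)
  ... | false = best-preserves z xs Pz (Pxs ∘ there)

-- Programs for the graph operations

isEdge′ : {M : ∀ i → Fin (ν i) → Fin (ν i) → Bool} {e : ∀ i → Fin (ν i) × Fin (ν i)} →
  Γ ⊢ (λ i → vec (ν i) (vec (ν i) bool)) ∋ M → Γ ⊢ (λ i → fin (ν i) ⊠ fin (ν i)) ∋ e →
  Γ ⊢ const bool ∋ (λ i → isEdge (M i) (e i))
isEdge′ M e = (toℕ′ (fst′ e) <ᵇ′ toℕ′ (snd′ e)) ∧′ lookup′ (lookup′ M (fst′ e)) (snd′ e)

edges′ : {M : ∀ i → Fin (ν i) → Fin (ν i) → Bool} →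
  Γ ⊢ (λ i → list (fin (ν i))) ∋ (λ i → allFin (ν i)) →
  Γ ⊢ (λ i → vec (ν i) (vec (ν i) bool)) ∋ M → Γ ⊢ const nat ∋ (λ i → edges (M i))
edges′ {M = M} V M′ = length′
  (filterᵇ′ {p = λ i → isEdge (M i)} (isEdge′ (wk M′) var₀) (cartesianProduct′ V V))

induced′ : {M : ∀ i → Fin (ν i) → Fin (ν i) → Bool} {S : ∀ i → Fin (ν i) → Bool} →
  Γ ⊢ (λ i → list (fin (ν i))) ∋ (λ i → allFin (ν i)) →
  Γ ⊢ (λ i → vec (ν i) (vec (ν i) bool)) ∋ M → Γ ⊢ (λ i → vec (ν i) bool) ∋ S →
  Γ ⊢ (λ i → vec (ν i) (vec (ν i) bool)) ∋ (λ i → induced (M i) (S i))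
induced′ V M S = tabulate′ V (tabulate′ (wk V)
  (lookup′ (lookup′ (wk (wk M)) (wk var₀)) var₀
    ∧′ (lookup′ (wk (wk S)) (wk var₀) ∧′ lookup′ (wk (wk S)) var₀)))

card′ : {S : ∀ i → Fin (ν i) → Bool} →
  Γ ⊢ (λ i → list (fin (ν i))) ∋ (λ i → allFin (ν i)) →
  Γ ⊢ (λ i → vec (ν i) bool) ∋ S → Γ ⊢ const nat ∋ (λ i → card (S i))
card′ {S = S} V S′ = length′ (filterᵇ′ {p = S} (lookup′ (wk S′) var₀) V)

insert′ : {S : ∀ i → Fin (ν i) → Bool} {v : ∀ i → Fin (ν i)} →
  Γ ⊢ (λ i → list (fin (ν i))) ∋ (λ i → allFin (ν i)) →
  Γ ⊢ (λ i → vec (ν i) bool) ∋ S → Γ ⊢ (λ i → fin (ν i)) ∋ v →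
  Γ ⊢ (λ i → vec (ν i) bool) ∋ (λ i → insert (S i) (v i))
insert′ V S v = tabulate′ V (lookup′ (wk S) var₀ ∨′ (toℕ′ var₀ ≡ᵇ′ toℕ′ (wk v)))

-- Each entry costs one node and at most 3 for the Boolean. The bound does not depend on the subset,
-- so loops may replace one subset by another freely.
size-bools : ∀ n (S : Fin n → Bool) → size (enc (vec n bool) S) ≤ 1 + 4 * n
size-bools zero    S = ≤-refl
size-bools (suc n) S = begin
  1 + (size (encodeBool (S Fin.zero)) + size (enc (vec n bool) (S ∘ Fin.suc)))
    ≤⟨ s≤s (+-mono-≤ (size-bool (S Fin.zero)) (size-bools n (S ∘ Fin.suc))) ⟩
  1 + (3 + (1 + 4 * n))  ≡⟨ cong suc (*-suc 4 n) ⟨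
  1 + 4 * suc n          ∎
  where
  open ≤-Reasoning
  size-bool : ∀ b → size (encodeBool b) ≤ 3
  size-bool true  = ≤-refl
  size-bool false = s≤s z≤n

-- A fold whose accumulator is a subset of Fin n satisfies the growth
-- condition automatically.
foldl-bools′ : {C : I → Ty} {l : ∀ i → List (El (C i))} {z : ∀ i → Fin (ν i) → Bool}
  {s : ∀ i → (Fin (ν i) → Bool) → El (C i) → Fin (ν i) → Bool} →
  Γ ⊢ (λ i → list (fin (ν i))) ∋ (λ i → allFin (ν i)) →
  Γ ▹ (λ i → vec (ν i) bool) ▹ C ∘ proj₁ ⊢ (λ p → vec (ν (proj₁ (proj₁ p))) bool) ∋
    (λ p → s (proj₁ (proj₁ p)) (proj₂ (proj₁ p)) (proj₂ p)) →
  Γ ⊢ (λ i → vec (ν i) bool) ∋ z → Γ ⊢ (λ i → list (C i)) ∋ l →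
  Γ ⊢ (λ i → vec (ν i) bool) ∋ (λ i → foldl (s i) (z i) (l i))
foldl-bools′ {ν = ν} {Γ = Γ} {C = C} {l} {z} {s} V S Z L =
  foldl′ {A = λ i → vec (ν i) bool} {s = s} growth (λ i a x → m≤n⇒m≤o+n _ (begin
    size (enc (vec (ν i) bool) (s i a x)) ≤⟨ size-bools (ν i) (s i a x) ⟩
    1 + 4 * ν i                           ≤⟨ s≤s (*-monoʳ-≤ 4 (n≤ i)) ⟩
    1 + 4 * eval (space (raw V)) (size (Γ i))
      ≤⟨ eval-mono growth (m≤n+m (size (Γ i)) (size (enc (C i) x))) ⟩
    eval growth (size (enc (C i) x) + size (Γ i)) ∎))
    S Z L
  where
  open ≤-Reasoning
  growth : Polynomial
  growth = lit 1 ⊕ (lit 4 ⊗ space (raw V))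
  n≤ : ∀ i → ν i ≤ eval (space (raw V)) (size (Γ i))
  n≤ i = begin
    ν i                                                ≡⟨ List.length-tabulate {n = ν i} id ⟨
    length (allFin (ν i))                              ≡⟨ List.length-map _ (allFin (ν i)) ⟨
    length (map (enc (fin (ν i))) (allFin (ν i)))      ≤⟨ length≤size (map (enc (fin (ν i))) (allFin (ν i))) ⟩
    size (enc (list (fin (ν i))) (allFin (ν i)))       ≤⟨ size≤ (raw V) i ⟩
    eval (space (raw V)) (size (Γ i))                  ∎

fill′ : {c : I → ℕ} {S : ∀ i → Fin (ν i) → Bool} {l : ∀ i → List (Fin (ν i))} →
  Γ ⊢ (λ i → list (fin (ν i))) ∋ (λ i → allFin (ν i)) →
  Γ ⊢ const nat ∋ c → Γ ⊢ (λ i → vec (ν i) bool) ∋ S → Γ ⊢ (λ i → list (fin (ν i))) ∋ l →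
  Γ ⊢ (λ i → vec (ν i) bool) ∋ (λ i → fill (c i) (S i) (l i))
fill′ {c = c} V C S L = foldl-bools′ {s = λ i S v → if card S <ᵇ c i then insert S v else S} V
  (if′ (card′ (wk (wk V)) (wk var₀) <ᵇ′ wk (wk C))
       (insert′ (wk (wk V)) (wk var₀) var₀) (wk var₀))
  S L

∅′ : Γ ⊢ (λ i → list (fin (ν i))) ∋ (λ i → allFin (ν i)) →
  Γ ⊢ (λ i → vec (ν i) bool) ∋ (λ i → const false)
∅′ V = tabulate′ V false′

windows′ : {k h : I → ℕ} {l m : ∀ i → List (Fin (ν i))} →
  Γ ⊢ (λ i → list (fin (ν i))) ∋ (λ i → allFin (ν i)) →
  Γ ⊢ const nat ∋ k → Γ ⊢ const nat ∋ h →
  Γ ⊢ (λ i → list (fin (ν i))) ∋ l → Γ ⊢ (λ i → list (fin (ν i))) ∋ m →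
  Γ ⊢ (λ i → vec (ν i) bool) ∋ (λ i → windows (k i) (h i) (l i) (m i))
windows′ V K H L M = fill′ V K (fill′ V H (∅′ V) L) (M ++′ V)

best′ : {M : ∀ i → Fin (ν i) → Fin (ν i) → Bool} {z : ∀ i → Fin (ν i) → Bool}
  {l : ∀ i → List (Fin (ν i) → Bool)} →
  Γ ⊢ (λ i → list (fin (ν i))) ∋ (λ i → allFin (ν i)) →
  Γ ⊢ (λ i → vec (ν i) (vec (ν i) bool)) ∋ M →
  Γ ⊢ (λ i → vec (ν i) bool) ∋ z → Γ ⊢ (λ i → list (vec (ν i) bool)) ∋ l →
  Γ ⊢ (λ i → vec (ν i) bool) ∋ (λ i → best (inside (M i)) (z i) (l i))
best′ {M = M} V M′ = foldl-bools′
  {s = λ i S S′ → if inside (M i) S <ᵇ inside (M i) S′ then S′ else S} V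
  (if′ (edges′ V₂ (induced′ V₂ (wk (wk M′)) (wk var₀)) <ᵇ′ edges′ V₂ (induced′ V₂ (wk (wk M′)) var₀))
       var₀ (wk var₀))
  where V₂ = wk (wk V)

incidence′ : {M : ∀ i → Fin (ν i) → Fin (ν i) → Bool} →
  Γ ⊢ (λ i → list (fin (ν i))) ∋ (λ i → allFin (ν i)) →
  Γ ⊢ const nat ∋ ν →
  Γ ⊢ (λ i → vec (ν i) (vec (ν i) bool)) ∋ M →
  Γ ⊢ (λ i → vec (ν i * (ν i + ν i)) (vec (ν i * ν i) bool)) ∋
    (λ i → BipartiteGraph.adj (incidenceModel (M i)))
incidence′ {ν = ν} {M = M} V N M′ =
  tabulate×′ {f = λ i x y → incident (M i) x (remQuot {ν i} (ν i) y)}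
    (cartesianProduct′ V (allFin′ (N +′ N)))
    (tabulate×′ {f = λ p → incident (M (proj₁ p)) (proj₂ p)} (wk (cartesianProduct′ V V))
      (isEdge′ (wk (wk M′)) var₀
        ∧′ ((toℕ′ (fst′ (wk var₀)) ≡ᵇ′ toℕ′ (fst′ var₀))
          ∨′ (toℕ′ (fst′ (wk var₀)) ≡ᵇ′ toℕ′ (snd′ var₀)))))

heavy′ : {M : ∀ i → Fin (ν i) → Fin (ν i) → Bool} {X : ∀ i → Subset (ν i * (ν i + ν i))} →
  Γ ⊢ (λ i → list (fin (ν i))) ∋ (λ i → allFin (ν i)) →
  Γ ⊢ const nat ∋ ν →
  Γ ⊢ (λ i → vec (ν i * (ν i + ν i)) bool) ∋ (λ i → lookup (X i)) →
  Γ ⊢ (λ i → vec (ν i) bool) ∋ (λ i → heavy (M i) (X i))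
heavy′ {X = X} V N X′ = tabulate′ V (not′
  (length′ (filterᵇ′ {p = λ p c → lookup (X (proj₁ p)) (combine (proj₂ p) c)}
     (lookup′ (wk (wk X′)) (combine′ (wk (wk N) +′ wk (wk N)) (wk var₀) var₀))
     (allFin′ (wk N +′ wk N)))
   <ᵇ′ wk N))

-- The approximation ratio

-- By the definition of `scale`, a rational `p / q` above `4 ε` means that its product with `1/4`
-- lies above `ε`.
/4≡*1/4 : ∀ p q .{{_ : NonZero q}} .{{_ : NonZero (4 * q)}} →
  (ℤ.+ p ℚ./ q) ℚ.* ℚ.1/ (ℤ.+ 4 ℚ./ 1) ≡ ℤ.+ p ℚ./ (4 * q)
/4≡*1/4 p q@(suc _) = ℚ.toℚᵘ-injective (begin-equality
  ℚ.toℚᵘ ((ℤ.+ p ℚ./ q) ℚ.* ℚ.1/ (ℤ.+ 4 ℚ./ 1))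
    ≃⟨ ℚ.toℚᵘ-homo-* (ℤ.+ p ℚ./ q) (ℚ.1/ (ℤ.+ 4 ℚ./ 1)) ⟩
  ℚ.toℚᵘ (ℤ.+ p ℚ./ q) ℚᵘ.* ℚ.toℚᵘ (ℚ.1/ (ℤ.+ 4 ℚ./ 1))
    ≃⟨ ℚᵘ.*-congʳ (ℚ.toℚᵘ-fromℚᵘ (ℤ.+ p ℚᵘ./ q)) ⟩
  (ℤ.+ p ℚᵘ./ q) ℚᵘ.* (ℤ.+ 1 ℚᵘ./ 4)
    ≃⟨ ℚᵘ.*≡* (cong₂ ℤ._*_ (ℤ.*-identityʳ (ℤ.+ p)) (cong ℤ.+_ (*-comm 4 q))) ⟩
  ℤ.+ p ℚᵘ./ (4 * q)                            ≃⟨ ℚ.toℚᵘ-fromℚᵘ (ℤ.+ p ℚᵘ./ (4 * q)) ⟨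
  ℚ.toℚᵘ (ℤ.+ p ℚ./ (4 * q))                    ∎)
  where open ℚᵘ.≤-Reasoning

*-^ : ∀ x y n → (x * y) ^ n ≡ x ^ n * y ^ n
*-^ x y zero    = refl
*-^ x y (suc n) = trans (cong (x * y *_) (*-^ x y n)) ([m*n]*[o*p]≡[m*o]*[n*p] x y (x ^ n) (y ^ n))

^-cancelʳ-≤ : ∀ n x y .{{_ : NonZero n}} → x ^ n ≤ y ^ n → x ≤ y
^-cancelʳ-≤ n x y xⁿ≤yⁿ = ≮⇒≥ (λ y<x → <⇒≱ (^-monoˡ-< n y<x) xⁿ≤yⁿ)

module _ (n c k u : ℕ) .{{_ : NonZero n}} where

  -- A chain through the size `X` of the deleted set: `n * u` is at most `X`, which is at most `c`
  -- times a power of `a` times `2 * n * k`. The factor `n` cancels, leaving `u` bounded by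
  -- `2 * c * k` times that power.
  cancel-scaling : ∀ X o a p q → n * u ≤ X → o ≤ (n + n) * k → X ^ q ≤ (c * o) ^ q * a ^ p →
    u ^ q ≤ (c * (k + k)) ^ q * a ^ p
  cancel-scaling X o a p q nu≤ o≤ X≤ = *-cancelˡ-≤ (n ^ q) {{m^n≢0 n q}} (begin
    n ^ q * u ^ q                      ≡⟨ *-^ n u q ⟨
    (n * u) ^ q                        ≤⟨ ^-monoˡ-≤ q nu≤ ⟩
    X ^ q                              ≤⟨ X≤ ⟩
    (c * o) ^ q * a ^ p                ≤⟨ *-monoˡ-≤ (a ^ p) (^-monoˡ-≤ q (*-monoʳ-≤ c o≤)) ⟩
    (c * ((n + n) * k)) ^ q * a ^ p    ≡⟨ cong (λ x → x ^ q * a ^ p)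
      (solve 3 (λ n c k → c :* ((n :+ n) :* k) := n :* (c :* (k :+ k))) refl n c k) ⟩
    (n * (c * (k + k))) ^ q * a ^ p    ≡⟨ cong (_* a ^ p) (*-^ n (c * (k + k)) q) ⟩
    n ^ q * (c * (k + k)) ^ q * a ^ p  ≡⟨ *-assoc (n ^ q) _ _ ⟩
    n ^ q * ((c * (k + k)) ^ q * a ^ p) ∎)
    where
    open ≤-Reasoning
    open +-*-Solver

module _ (c k h u : ℕ) .{{_ : NonZero c}} .{{_ : NonZero h}} (h≤k : h ≤ k) (k≤3h : k ≤ 3 * h) where

  blocks : ℕ
  blocks = suc (u ℕ./ h)

  u≤blocks*h : u ≤ blocks * h
  u≤blocks*h = ≤-trans (≤-reflexive (m≡m%n+[m/n]*n u h)) (+-monoˡ-≤ (u ℕ./ h * h) (<⇒≤ (m%n<n u h)))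

  -- Rounding up costs at most one block, whence `h * blocks ≤ 2 * (u ⊔ h)`; the maximum covers the
  -- case of `U` smaller than one block. The 12 is 2 from rounding, 2 from `k + k` and 3 from
  -- `k ≤ 3 * h`.
  blocks-bound : ∀ a p q .{{_ : NonZero a}} → u ^ q ≤ (c * (k + k)) ^ q * a ^ p →
    blocks ^ q ≤ (12 * c) ^ q * a ^ p
  blocks-bound a p q u≤ = *-cancelˡ-≤ (h ^ q) {{m^n≢0 h q}} (begin
    h ^ q * blocks ^ q               ≡⟨ *-^ h blocks q ⟨
    (h * blocks) ^ q                 ≤⟨ ^-monoˡ-≤ q h*blocks≤ ⟩
    (2 * (u ⊔ h)) ^ q                ≡⟨ *-^ 2 (u ⊔ h) q ⟩
    2 ^ q * (u ⊔ h) ^ q              ≤⟨ *-monoʳ-≤ (2 ^ q) max≤ ⟩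
    2 ^ q * (D ^ q * a ^ p)          ≡⟨ *-assoc (2 ^ q) _ _ ⟨
    2 ^ q * D ^ q * a ^ p            ≡⟨ cong (_* a ^ p) (*-^ 2 D q) ⟨
    (2 * D) ^ q * a ^ p              ≤⟨ *-monoˡ-≤ (a ^ p) (^-monoˡ-≤ q 2D≤) ⟩
    (h * (12 * c)) ^ q * a ^ p       ≡⟨ cong (_* a ^ p) (*-^ h (12 * c) q) ⟩
    h ^ q * (12 * c) ^ q * a ^ p     ≡⟨ *-assoc (h ^ q) _ _ ⟩
    h ^ q * ((12 * c) ^ q * a ^ p)   ∎)
    where
    open ≤-Reasoning
    open +-*-Solver
    D = c * (k + k)
    h*blocks≤ : h * blocks ≤ 2 * (u ⊔ h)
    h*blocks≤ = begin
      h * suc (u ℕ./ h)     ≡⟨ *-comm h (suc (u ℕ./ h)) ⟩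
      h + u ℕ./ h * h       ≤⟨ +-mono-≤ (m≤n⊔m u h) (≤-trans (m/n*n≤m u h) (m≤m⊔n u h)) ⟩
      (u ⊔ h) + (u ⊔ h)   ≡⟨ cong (λ x → (u ⊔ h) + x) (+-identityʳ (u ⊔ h)) ⟨
      2 * (u ⊔ h)         ∎
    h≤D : h ≤ D
    h≤D = ≤-trans (≤-trans h≤k (m≤m+n k k)) (m≤n*m (k + k) c)
    max≤ : (u ⊔ h) ^ q ≤ D ^ q * a ^ p
    max≤ with ⊔-sel u h
    ... | inj₁ eq = subst (λ m → m ^ q ≤ D ^ q * a ^ p) (sym eq) u≤
    ... | inj₂ eq = subst (λ m → m ^ q ≤ D ^ q * a ^ p) (sym eq)
      (≤-trans (^-monoˡ-≤ q h≤D) (m≤m*n (D ^ q) (a ^ p) {{m^n≢0 a p}}))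
    2D≤ : 2 * D ≤ h * (12 * c)
    2D≤ = begin
      2 * (c * (k + k))         ≤⟨ *-monoʳ-≤ 2 (*-monoʳ-≤ c (+-mono-≤ k≤3h k≤3h)) ⟩
      2 * (c * (3 * h + 3 * h)) ≡⟨ solve 2 (λ c h →
        con 2 :* (c :* (con 3 :* h :+ con 3 :* h)) := h :* (con 12 :* c)) refl c h ⟩
      h * (12 * c)              ∎

module _ (n c b opt M : ℕ) (opt≤ : opt ≤ b * b * M) where

  -- The hypothesis on `b` has exponent `p / (4 * q)`, so everything is raised to the power `4 * q`.
  -- The square of `b` then contributes the square of `(2 * n ^ 2) ^ p`, that is
  -- `4 ^ p * n ^ (4 * p)`. As `p ≤ q`, the factor `4 ^ p` is at most `4 ^ (4 * q)` and turns 144,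
  -- the square of 12, into 576.
  fourth-root : ∀ p q → p ≤ q → b ^ (4 * q) ≤ (12 * c) ^ (4 * q) * (n * (n + n)) ^ p →
    opt ^ q ≤ (576 * c * c * M) ^ q * n ^ p
  fourth-root p q p≤q b≤ = ^-cancelʳ-≤ 4 _ _ (begin
    (opt ^ q) ^ 4                    ≡⟨ ^4 opt ⟩
    opt ^ (4 * q)                    ≤⟨ ^-monoˡ-≤ (4 * q) opt≤ ⟩
    (b * b * M) ^ (4 * q)
      ≡⟨ trans (*-^ (b * b) M (4 * q)) (cong (_* M ^ (4 * q)) (*-^ b b (4 * q))) ⟩
    b ^ (4 * q) * b ^ (4 * q) * M ^ (4 * q) ≤⟨ *-monoˡ-≤ (M ^ (4 * q)) (*-mono-≤ b≤ b≤) ⟩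
    (K * L) * (K * L) * M ^ (4 * q)
      ≡⟨ solve 3 (λ K L M → (K :* L) :* (K :* L) :* M := (K :* K :* M) :* (L :* L))
           refl K L (M ^ (4 * q)) ⟩
    (K * K * M ^ (4 * q)) * (L * L)  ≡⟨ cong₂ _*_ K*K*M L*L ⟩
    (144 * c * c * M) ^ (4 * q) * (4 ^ p * (n ^ p) ^ 4)
      ≤⟨ *-monoʳ-≤ ((144 * c * c * M) ^ (4 * q))
           (*-monoˡ-≤ ((n ^ p) ^ 4) (^-monoʳ-≤ 4 (≤-trans p≤q (m≤n*m q 4)))) ⟩
    (144 * c * c * M) ^ (4 * q) * (4 ^ (4 * q) * (n ^ p) ^ 4)
      ≡⟨ *-assoc ((144 * c * c * M) ^ (4 * q)) _ _ ⟨
    (144 * c * c * M) ^ (4 * q) * 4 ^ (4 * q) * (n ^ p) ^ 4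
      ≡⟨ cong (_* (n ^ p) ^ 4) (*-^ (144 * c * c * M) 4 (4 * q)) ⟨
    (144 * c * c * M * 4) ^ (4 * q) * (n ^ p) ^ 4
      ≡⟨ cong (λ x → x ^ (4 * q) * (n ^ p) ^ 4) (solve 2 (λ c M →
           con 144 :* c :* c :* M :* con 4 := con 576 :* c :* c :* M) refl c M) ⟩
    (576 * c * c * M) ^ (4 * q) * (n ^ p) ^ 4    ≡⟨ cong (_* (n ^ p) ^ 4) (^4 (576 * c * c * M)) ⟨
    ((576 * c * c * M) ^ q) ^ 4 * (n ^ p) ^ 4    ≡⟨ *-^ ((576 * c * c * M) ^ q) (n ^ p) 4 ⟨
    ((576 * c * c * M) ^ q * n ^ p) ^ 4 ∎)
    where
    open ≤-Reasoning
    open +-*-Solver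
    K = (12 * c) ^ (4 * q)
    L = (n * (n + n)) ^ p
    ^4 : ∀ x → (x ^ q) ^ 4 ≡ x ^ (4 * q)
    ^4 x = trans (^-*-assoc x q 4) (cong (x ^_) (*-comm q 4))
    K*K*M : K * K * M ^ (4 * q) ≡ (144 * c * c * M) ^ (4 * q)
    K*K*M = trans (cong (_* M ^ (4 * q)) (sym (*-^ (12 * c) (12 * c) (4 * q))))
      (trans (sym (*-^ (12 * c * (12 * c)) M (4 * q)))
        (cong (_^ (4 * q)) (solve 2 (λ c M →
          con 12 :* c :* (con 12 :* c) :* M := con 144 :* c :* c :* M) refl c M)))
    L*L : L * L ≡ 4 ^ p * (n ^ p) ^ 4
    L*L = trans (sym (*-^ (n * (n + n)) (n * (n + n)) p))
      (trans (cong (_^ p) (solve 1 (λ n →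
          n :* (n :+ n) :* (n :* (n :+ n)) := con 4 :* (n :* (n :* (n :* (n :* con 1))))) refl n))
        (trans (*-^ 4 (n ^ 4) p) (cong (4 ^ p *_) (trans (^-*-assoc n 4 p)
          (trans (cong (n ^_) (*-comm 4 p)) (sym (^-*-assoc n p 4)))))))

-- For exponents p / q > 1 the factor 4 ^ p would not be bounded by a constant to
-- the power q; there the case p / q = 1, available because ε < 1/4, suffices.
approximation-bound : ∀ (ε : ℝ) → ε <ℚ (ℤ.+ 1 ℚ./ 4) →
  ∀ n c b opt M .{{_ : NonZero n}} → opt ≤ b * b * M →
  (∀ p q .{{_ : NonZero q}} → ε <ℚ (ℤ.+ p ℚ./ q) → b ^ q ≤ (12 * c) ^ q * (n * (n + n)) ^ p) →
  opt ≤ 576 * c * c · n ^[ scale (ℤ.+ 4 ℚ./ 1) ε ]· M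
approximation-bound ε ε<¼ n c b opt M opt≤ b≤ p q@(suc _) 4ε<p/q with p ≤? q
... | yes p≤q = fourth-root n c b opt M opt≤ p q p≤q
  (b≤ p (4 * q) (subst (ε <ℚ_) (/4≡*1/4 p q) 4ε<p/q))
... | no  p≰q = begin
  opt ^ q                                ≡⟨ cong (_^ q) (*-identityʳ opt) ⟨
  (opt ^ 1) ^ q                          ≤⟨ ^-monoˡ-≤ q (fourth-root n c b opt M opt≤ 1 1 ≤-refl (b≤ 1 4 ε<¼)) ⟩
  ((576 * c * c * M) ^ 1 * n ^ 1) ^ q
    ≡⟨ cong₂ (λ x y → (x * y) ^ q) (*-identityʳ (576 * c * c * M)) (*-identityʳ n) ⟩
  (576 * c * c * M * n) ^ q              ≡⟨ *-^ (576 * c * c * M) n q ⟩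
  (576 * c * c * M) ^ q * n ^ q          ≤⟨ *-monoʳ-≤ ((576 * c * c * M) ^ q) (^-monoʳ-≤ n (<⇒≤ (≰⇒> p≰q))) ⟩
  (576 * c * c * M) ^ q * n ^ p          ∎
  where open ≤-Reasoning

blocks-approximation : ∀ (ε : ℝ) → ε <ℚ (ℤ.+ 1 ℚ./ 4) → ∀ n c k h u X o opt M
  .{{_ : NonZero n}} .{{_ : NonZero c}} .{{_ : NonZero h}} (h≤k : h ≤ k) (k≤3h : k ≤ 3 * h) →
  n * u ≤ X → o ≤ (n + n) * k → X ≤ c · n * (n + n) ^[ ε ]· o →
  opt ≤ blocks c k h u h≤k k≤3h * blocks c k h u h≤k k≤3h * M →
  opt ≤ 576 * c * c · n ^[ scale (ℤ.+ 4 ℚ./ 1) ε ]· M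
blocks-approximation ε ε<¼ n c k h u X o opt M h≤k k≤3h nu≤X o≤ X≤ opt≤ =
  approximation-bound ε ε<¼ n c (blocks c k h u h≤k k≤3h) opt M opt≤ λ p q ε<p/q →
    blocks-bound c k h u h≤k k≤3h (n * (n + n)) p q
      (cancel-scaling n c k u X o (n * (n + n)) p q nu≤X o≤ (X≤ p q ε<p/q))
  where
  instance
    n+n≢0 : NonZero (n + n)
    n+n≢0 = >-nonZero (<-≤-trans (>-nonZero⁻¹ n) (m≤m+n n n))
    n*[n+n]≢0 : NonZero (n * (n + n))
    n*[n+n]≢0 = m*n≢0 n (n + n)

-- The reduction

toList-tabulate : ∀ {A : Set} {n} (f : Fin n → A) → Vec.toList (Vec.tabulate f) ≡ List.tabulate f
toList-tabulate {n = zero}  f = refl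
toList-tabulate {n = suc n} f = cong (f Fin.zero ∷_) (toList-tabulate (f ∘ Fin.suc))

encodeSubset≡enc : ∀ {n} (S : Fin n → Bool) → encodeSubset (Vec.tabulate S) ≡ enc (vec n bool) S
encodeSubset≡enc S = cong encodeList (trans (cong (map encodeBool) (toList-tabulate S))
  (List.map-tabulate S encodeBool))

encodeSubset≡enc-lookup : ∀ {n} (X : Subset n) → encodeSubset X ≡ enc (vec n bool) (lookup X)
encodeSubset≡enc-lookup X = trans (cong encodeSubset (sym (Vec.tabulate∘lookup X)))
  (encodeSubset≡enc (lookup X))

encodeMatrix≡enc : ∀ {m n} (M : Fin m → Fin n → Bool) →
  encodeMatrix M ≡ enc (vec m (vec n bool)) M
encodeMatrix≡enc M = cong encodeList (trans (toList-tabulate _)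
  (List.tabulate-cong (λ i → encodeSubset≡enc (M i))))

∈-concatMap : ∀ {A B : Set} (f : A → List B) {x y xs} → x ∈ xs → y ∈ f x → y ∈ concatMap f xs
∈-concatMap f x∈ y∈ = ∈-concatMap⁺ f (Any.map (λ { refl → y∈ }) x∈)

search-minimum : ∀ {P : ℕ → Set} → Decidable P → ∀ b → ∃ (IsMinimum P) ⊎ (∀ {w} → w < b → ¬ P w)
search-minimum P? zero    = inj₂ λ ()
search-minimum P? (suc b) with search-minimum P? b
... | inj₁ found = inj₁ found
... | inj₂ none with P? b
...   | yes Pb = inj₁ (b , Pb , λ w Pw → ≮⇒≥ (λ w<b → none w<b Pw))
...   | no ¬Pb = inj₂ λ {w} w<1+b Pw → none (≤∧≢⇒< (s≤s⁻¹ w<1+b) (λ { refl → ¬Pb Pw })) Pw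

-- The given algorithm is only bound by its promise when an optimum exists. Existence is obtained
-- constructively: feasibility is decidable, and sizes up to that of `X` are searched in increasing
-- order.
feasible⇒optimum : ∀ I X → RankReduction.Feasible I X → ∃ (RankReduction.IsOptimum I)
feasible⇒optimum I X feasible with search-minimum
    (λ s → anySubset? (λ X → (rank model (∁ X) + k ≤? rank model ⊤) ×-dec (∣ X ∣ ≟ s))) (suc ∣ X ∣)
  where open RankReduction I
... | inj₁ found = found
... | inj₂ none  = contradiction (X , feasible , refl) (none ≤-refl)

-- The extreme case is `m = 3`, where the half rounds down to 1.
⌊n/2⌋-bound : ∀ m → 2 ≤ m → m ≤ 3 * ⌊ m /2⌋
⌊n/2⌋-bound (suc zero)             (s≤s ())
⌊n/2⌋-bound (suc (suc zero))       _ = s≤s (s≤s z≤n)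
⌊n/2⌋-bound (suc (suc (suc zero))) _ = ≤-refl
⌊n/2⌋-bound (suc (suc m@(suc (suc _)))) _ = ≤-trans (s≤s (s≤s (⌊n/2⌋-bound m (s≤s (s≤s z≤n)))))
  (≤-trans (n≤1+n _) (≤-reflexive (sym (*-suc 3 ⌊ m /2⌋))))

-- The algorithm and its program

module Reduction (ε : ℝ) (c : ℕ) (P : Program) (A d : ℕ)
  (solve : (I : RankReduction) → ∃[ y ] ∃[ t ] (Run P (RankReduction.encode I) y t
    × t ≤ A * size (RankReduction.encode I) ^ d + A
    × (∀ opt → RankReduction.IsOptimum I opt → ∃[ X ] (y ≡ encodeSubset X
        × RankReduction.Feasible I X
        × ∣ X ∣ ≤ c · RankReduction.a I ^[ ε ]· opt)))) where

  open DensestSubgraph using (n; k; graph)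

  adjacency : (D : DensestSubgraph) → Fin (n D) → Fin (n D) → Bool
  adjacency D = Graph.adj (graph D)

  E : DensestSubgraph → ℕ
  E D = edges (adjacency D)

  -- The index `t` stands for the target `p = suc (toℕ t)`, so exactly the targets from 1 to the
  -- number of edges are asked.
  Query : Set
  Query = Σ DensestSubgraph (Fin ∘ E)

  query : Query → RankReduction
  query (D , t) = record { model = incidenceModel (adjacency D) ; k = suc (toℕ t) ; k>0 = z<s }

  abstract
    query-optimum : ∀ Q → ∃ (RankReduction.IsOptimum (query Q))
    -- Deleting all copies of all vertices is feasible, because the target does not exceed the
    -- number of edges.
    query-optimum Q@(D , t) = feasible⇒optimum (query Q) (blowup (adjacency D) (const true))
      (inside⇒feasible (adjacency D) (const true) (suc (toℕ t)) (≤-trans (Fin.toℕ<n t)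
        (count-mono _ _ (pairs (n D)) λ (i , j) _ ij →
          from (T-∧ {toℕ i <ᵇ toℕ j}) (proj₁ (to T-∧ ij) ,
            from (T-∧ {adjacency D i j}) (proj₂ (to (T-∧ {toℕ i <ᵇ toℕ j}) ij) , _)))))

  optimum : Query → ℕ
  optimum Q = proj₁ (query-optimum Q)

  answer : ∀ Q → ∃[ X ] (proj₁ (solve (query Q)) ≡ encodeSubset X
    × RankReduction.Feasible (query Q) X
    × ∣ X ∣ ≤ c · RankReduction.a (query Q) ^[ ε ]· optimum Q)
  answer Q = proj₂ (proj₂ (proj₂ (proj₂ (solve (query Q))))) (optimum Q) (proj₂ (query-optimum Q))

  deleted : ∀ Q → Subset (RankReduction.a (query Q))
  deleted Q = proj₁ (answer Q)

  -- The space bound comes from correctness, not from running time: a unit-cost program may output a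
  -- tree exponentially larger than its number of steps. Every query has an optimum, so the output
  -- encodes a subset and its size is linear in that of the query.
  oracle : RankReduction.encode ∘ query ⟶ λ Q → encodeSubset (deleted Q)
  oracle = record
    { program = P
    ; time    = (lit A ⊗ power d) ⊕ lit A
    ; space   = lit 1 ⊕ (lit 4 ⊗ var)
    ; steps   = λ Q → proj₁ (proj₂ (solve (query Q)))
    ; runs    = λ Q → subst (λ y → Run P (RankReduction.encode (query Q)) y (proj₁ (proj₂ (solve (query Q)))))
        (proj₁ (proj₂ (answer Q))) (proj₁ (proj₂ (proj₂ (solve (query Q)))))
    ; steps≤  = λ Q → ≤-trans (proj₁ (proj₂ (proj₂ (proj₂ (solve (query Q))))))
        (≤-reflexive (cong (λ x → A * x + A) (sym (eval-power d (size (RankReduction.encode (query Q)))))))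
    ; size≤   = size≤′
    }
    where
    open ≤-Reasoning
    size≤′ : ∀ Q → size (encodeSubset (deleted Q)) ≤ 1 + 4 * size (RankReduction.encode (query Q))
    size≤′ Q = begin
      size (encodeSubset (deleted Q))  ≡⟨ cong size (encodeSubset≡enc-lookup (deleted Q)) ⟩
      size (enc (vec a bool) (lookup (deleted Q))) ≤⟨ size-bools a (lookup (deleted Q)) ⟩
      1 + 4 * a                        ≤⟨ s≤s (*-monoʳ-≤ 4 (≤-trans a≤ (m≤n⇒m≤1+n (m≤m+n _ _)))) ⟩
      1 + 4 * size (RankReduction.encode (query Q)) ∎
      where
      open RankReduction (query Q) using (a; adj)
      a≤ : a ≤ size (encodeMatrix adj)
      a≤ = ≤-trans (≤-reflexive (sym (Vec.length-toList (Vec.tabulate (λ i → encodeSubset (Vec.tabulate (adj i)))))))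
        (length≤size (Vec.toList (Vec.tabulate (λ i → encodeSubset (Vec.tabulate (adj i))))))

  cover : (Q : Query) → Fin (n (proj₁ Q)) → Bool
  cover (D , t) = heavy (adjacency D) (deleted (D , t))

  coverList : (Q : Query) → List (Fin (n (proj₁ Q)))
  coverList (D , t) = filterᵇ (cover (D , t)) (allFin (n D))

  -- Every `h` below `k` and every pair of offsets up to `n` is tried, so neither halving nor block
  -- boundaries have to be programmed; the intended choices are among these.
  candidates : (D : DensestSubgraph) → List (Fin (n D) → Bool)
  candidates D =
    concatMap (λ t → concatMap (λ r → concatMap (λ s → map (λ h →
        windows (k D) h (drop r (coverList (D , t))) (drop s (coverList (D , t))))
      (upTo (k D))) (upTo (suc (n D)))) (upTo (suc (n D)))) (allFin (E D))

  -- A graph without edges gives no queries and no candidates; the answer still needs `k` vertices.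
  default : (D : DensestSubgraph) → Fin (n D) → Bool
  default D = fill (k D) (const false) (allFin (n D))

  solution : (D : DensestSubgraph) → Fin (n D) → Bool
  solution D = best (inside (adjacency D)) (default D) (candidates D)

  subgraph : (D : DensestSubgraph) → Subgraph (graph D)
  subgraph D = record
    { vertices = Vec.tabulate (solution D)
    ; adj      = induced (adjacency D) (solution D)
    ; symm     = λ {i} {j} ij → let Gij , SS = to (T-∧ {adjacency D i j}) ij
                                    Si , Sj  = to (T-∧ {solution D i}) SS in
                   from (T-∧ {adjacency D j i})
                     (Graph.symm (graph D) Gij , from (T-∧ {solution D j}) (Sj , Si))
    ; ends     = λ {i} {j} ij → let Si , Sj = to (T-∧ {solution D i})
                                                (proj₂ (to (T-∧ {adjacency D i j}) ij)) in
                   T⇒∈ (subst T (sym (Vec.lookup∘tabulate (solution D) i)) Si)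
                 , T⇒∈ (subst T (sym (Vec.lookup∘tabulate (solution D) j)) Sj)
    ; edges⊆   = λ {i} {j} ij → proj₁ (to (T-∧ {adjacency D i j}) ij)
    }

  -- Keeps the instance accessible in contexts extended by loop variables.
  record Input {I : Set} (Γ : I → Tree) (D : I → DensestSubgraph) : Set where
    constructor input
    field
      instance′ : Γ ⟶ DensestSubgraph.encode ∘ D

  open Input

  weaken : ∀ {I : Set} {Γ : I → Tree} {D : I → DensestSubgraph} {B : I → Ty} →
           Input Γ D → Input (Γ ▹ B) (D ∘ proj₁)
  weaken (input β) = input (tailᵗ ⨾ᵗ reindexᵗ proj₁ β)

  module _ {I : Set} {Γ : I → Tree} {D : I → DensestSubgraph} (β : Input Γ D) where

    adjacency′ : Γ ⊢ (λ i → vec (n (D i)) (vec (n (D i)) bool)) ∋ (λ i → adjacency (D i))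
    adjacency′ = ⟪ instance′ β ⨾ᵗ castᵗ (λ i → encodeMatrix≡enc (adjacency (D i))) headᵗ ⟫

    k′ : Γ ⊢ const nat ∋ (λ i → k (D i))
    k′ = ⟪ instance′ β ⨾ᵗ tailᵗ ⟫

    n′ : Γ ⊢ const nat ∋ (λ i → n (D i))
    n′ = reval (λ i → List.length-tabulate (adjacency (D i))) (length′ (toList′ adjacency′))

    vertices′ : Γ ⊢ (λ i → list (fin (n (D i)))) ∋ (λ i → allFin (n (D i)))
    vertices′ = allFin′ n′

    cover′ : {t : ∀ i → Fin (E (D i))} → Γ ⊢ (λ i → fin (E (D i))) ∋ t →
      Γ ⊢ (λ i → vec (n (D i)) bool) ∋ (λ i → cover (D i , t i))
    cover′ {t} T′ = heavy′ {M = λ i → adjacency (D i)} {X = λ i → deleted (D i , t i)} vertices′ n′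
      ⟪ castᵗ (λ i → encodeSubset≡enc-lookup (deleted (D i , t i)))
          (nodeᵗ (castᵗ (λ i → sym (encodeMatrix≡enc
                          (BipartiteGraph.adj (incidenceModel (adjacency (D i))))))
              (raw (incidence′ vertices′ n′ adjacency′))) (raw (suc′ (toℕ′ T′)))
           ⨾ᵗ reindexᵗ (λ i → D i , t i) oracle) ⟫

    coverList′ : {t : ∀ i → Fin (E (D i))} → Γ ⊢ (λ i → fin (E (D i))) ∋ t →
      Γ ⊢ (λ i → list (fin (n (D i)))) ∋ (λ i → coverList (D i , t i))
    coverList′ {t} T′ =
      filterᵇ′ {p = λ i → cover (D i , t i)} (lookup′ (wk (cover′ T′)) var₀) vertices′

  candidates′ : DensestSubgraph.encode ⊢ (λ D → list (vec (n D) bool)) ∋ candidates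
  candidates′ =
    concatMap′ (concatMap′ (concatMap′ (map′
      (windows′ (vertices′ β₄) (k′ β₄) var₀
        -- The query is rebuilt and the given algorithm rerun in every innermost iteration, which is
        -- wasteful but polynomial.
        (drop′ (wk (wk var₀)) (coverList′ β₄ (wk (wk (wk var₀)))))
        (drop′ (wk var₀) (coverList′ β₄ (wk (wk (wk var₀))))))
      (upTo′ (k′ β₃))) (upTo′ (suc′ (n′ β₂)))) (upTo′ (suc′ (n′ β₁))))
      (allFin′ (edges′ (vertices′ β₀) (adjacency′ β₀)))
    where
    β₀ : Input DensestSubgraph.encode id
    β₀ = input idᵗ
    β₁ = weaken β₀
    β₂ = weaken β₁
    β₃ = weaken β₂
    β₄ = weaken β₃

  solution′ : DensestSubgraph.encode ⊢ (λ D → vec (n D) bool) ∋ solution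
  solution′ = best′ V (adjacency′ β) (fill′ V (k′ β) (∅′ V) V) candidates′
    where
    β : Input DensestSubgraph.encode id
    β = input idᵗ
    V = vertices′ β

  algorithm : DensestSubgraph.encode ⟶ λ D → encodeSubgraph (subgraph D)
  algorithm = castᵗ
    (λ D → sym (cong₂ node (encodeSubset≡enc (solution D))
      (encodeMatrix≡enc (induced (adjacency D) (solution D)))))
    (nodeᵗ (raw solution′) (raw (induced′ (vertices′ β) (adjacency′ β) solution′)))
    where
    β : Input DensestSubgraph.encode id
    β = input idᵗ

  ∈-candidates⁺ : ∀ D t {r s h} → r ≤ n D → s ≤ n D → h < k D →
    windows (k D) h (drop r (coverList (D , t))) (drop s (coverList (D , t))) ∈ candidates D
  ∈-candidates⁺ D t {r} {s} r≤n s≤n h<k =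
    ∈-concatMap _ (∈-allFin t) (∈-concatMap _ (∈-upTo⁺ (s≤s r≤n)) (∈-concatMap _ (∈-upTo⁺ (s≤s s≤n))
      (∈-map⁺ (λ h → windows (k D) h (drop r (coverList (D , t))) (drop s (coverList (D , t))))
        (∈-upTo⁺ h<k))))

  candidates-card : ∀ D {S} → S ∈ candidates D → card S ≡ k D
  candidates-card D S∈ with find (∈-concatMap⁻ _ {xs = allFin (E D)} S∈)
  ... | t , _ , S∈₁ with find (∈-concatMap⁻ _ {xs = upTo (suc (n D))} S∈₁)
  ...   | r , _ , S∈₂ with find (∈-concatMap⁻ _ {xs = upTo (suc (n D))} S∈₂)
  ...     | s , _ , S∈₃ with ∈-map⁻ _ S∈₃
  ...       | h , h∈ , refl = windows-card {k = k D} {h} (drop r (coverList (D , t)))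
    (drop s (coverList (D , t))) (<⇒≤ (∈-upTo⁻ h∈)) (DensestSubgraph.k≤n D)

  solution-card : ∀ D → card (solution D) ≡ k D
  solution-card D = best-preserves (inside (adjacency D)) {P = λ S → card S ≡ k D} (default D) (candidates D)
    (fill-card (k D) (allFin (n D)) (const false) (≤-trans (≤-reflexive (card-∅ (n D))) z≤n)
      (DensestSubgraph.k≤n D) ∈-allFin)
    (candidates-card D)

  -- The approximation guarantee

  module Analysis (c>0 : 0 < c) (ε<¼ : ε <ℚ (ℤ.+ 1 ℚ./ 4)) (D : DensestSubgraph)
    (H : Subgraph (graph D)) (∣H∣≡k : ∣ H ∣ᵥ ≡ k D) (o : ℕ) (∣∣H∣∣≡ : ∣∣ H ∣∣ ≡ suc o) where

    private
      adj = adjacency D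
      W : Fin (n D) → Bool
      W = lookup (Subgraph.vertices H)

      W-card : card W ≡ k D
      W-card = trans (sym (∣∣≡count (Subgraph.vertices H))) ∣H∣≡k

      opt≤W : suc o ≤ inside adj W
      opt≤W = begin
        suc o                     ≡⟨ ∣∣H∣∣≡ ⟨
        ∣∣ H ∣∣                   ≡⟨ edgeCount≡edges (Subgraph.adj H) ⟩
        edges (Subgraph.adj H)    ≤⟨ count-mono _ _ (pairs (n D)) (λ (i , j) _ ij →
          let i<j , Hij = to (T-∧ {toℕ i <ᵇ toℕ j}) ij
              Wi , Wj   = Subgraph.ends H Hij in
          from (T-∧ {toℕ i <ᵇ toℕ j}) (i<j , from (T-∧ {adj i j})
            (Subgraph.edges⊆ H Hij , from T-∧ (∈⇒T Wi , ∈⇒T Wj)))) ⟩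
        inside adj W              ∎
        where open ≤-Reasoning

      -- The query whose target is the number of edges of `H`; it is among those tried, since `H`
      -- has no more edges than the graph.
      t : Fin (E D)
      t = fromℕ< (≤-trans opt≤W (≤-trans (m≤m+n (inside adj W) (outside adj W))
            (≤-reflexive (sym (inside+outside adj W)))))

      t≡o : toℕ t ≡ o
      t≡o = Fin.toℕ-fromℕ< _

      U = cover (D , t)
      X = deleted (D , t)

      opt≤U : suc o ≤ inside adj U
      opt≤U = subst (λ o → suc o ≤ inside adj U) t≡o
        (feasible⇒inside adj X (suc (toℕ t)) (proj₁ (proj₂ (proj₂ (answer (D , t))))))

      -- The blow-up of the vertex set of `H` is a feasible competitor.
      query-optimum≤ : optimum (D , t) ≤ (n D + n D) * k D
      query-optimum≤ = begin
        optimum (D , t)         ≤⟨ proj₂ (proj₂ (query-optimum (D , t))) _ (blowup adj W ,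
          inside⇒feasible adj W (suc (toℕ t)) (subst (λ o → suc o ≤ inside adj W) (sym t≡o) opt≤W) , refl) ⟩
        ∣ blowup adj W ∣        ≤⟨ blowup-card adj W ⟩
        (n D + n D) * card W    ≡⟨ cong ((n D + n D) *_) W-card ⟩
        (n D + n D) * k D       ∎
        where open ≤-Reasoning

      2≤k : 2 ≤ k D
      2≤k = subst (2 ≤_) W-card (edge⇒2≤card adj W (≤-trans z<s opt≤W))

      h = ⌊ k D /2⌋

      instance
        n≢0 : NonZero (n D)
        n≢0 = >-nonZero (<-≤-trans (DensestSubgraph.k>0 D) (DensestSubgraph.k≤n D))
        c≢0 : NonZero c
        c≢0 = >-nonZero c>0
        h≢0 : NonZero h
        h≢0 = >-nonZero (⌊n/2⌋-mono 2≤k)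

      h≤k : h ≤ k D
      h≤k = ⌊n/2⌋≤n (k D)

      2h≤k : h + h ≤ k D
      2h≤k = ≤-trans (+-monoʳ-≤ h (⌊n/2⌋≤⌈n/2⌉ (k D))) (≤-reflexive (⌊n/2⌋+⌈n/2⌉≡n (k D)))

      h<k : h < k D
      h<k = ≤-trans (m<m+n h (>-nonZero⁻¹ h)) 2h≤k

      u = card U
      k≤3h = ⌊n/2⌋-bound (k D) 2≤k
      b = blocks c (k D) h u h≤k k≤3h
      M = inside adj (solution D)

      opt≤b*b*M : suc o ≤ b * b * M
      opt≤b*b*M = ≤-trans opt≤U (inside≤blocks adj U (k D) h b M 2h≤k
        (u≤blocks*h c (k D) h u h≤k k≤3h)
        (λ r≤n s≤n → best-≥ (inside adj) (default D) (candidates D) (∈-candidates⁺ D t r≤n s≤n h<k)))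

    guarantee : suc o ≤ 576 * c * c · n D ^[ scale (ℤ.+ 4 ℚ./ 1) ε ]· M
    guarantee = blocks-approximation ε ε<¼ (n D) c (k D) h u ∣ X ∣ (optimum (D , t)) (suc o) M
      {{n≢0}} {{c≢0}} {{h≢0}} h≤k k≤3h (heavy-card adj X) query-optimum≤
      (proj₂ (proj₂ (proj₂ (answer (D , t))))) opt≤b*b*M

  guaranteed : 0 < c → ε <ℚ (ℤ.+ 1 ℚ./ 4) → ∀ D opt → DensestSubgraph.IsOptimum D opt →
    opt ≤ 576 * c * c · n D ^[ scale (ℤ.+ 4 ℚ./ 1) ε ]· ∣∣ subgraph D ∣∣
  -- A zero optimum is treated apart because `k` may then be 1, with no block of positive size.
  -- Matching on `suc q` lets `0 ^ suc q` reduce to 0.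
  guaranteed c>0 ε<¼ D zero    _ p (suc q) _ = z≤n
  guaranteed c>0 ε<¼ D (suc o) ((H , ∣H∣≡k , ∣∣H∣∣≡) , _) =
    subst (λ M → suc o ≤ 576 * c * c · n D ^[ scale (ℤ.+ 4 ℚ./ 1) ε ]· M)
      (sym (edgeCount≡edges (induced (adjacency D) (solution D))))
      (Analysis.guarantee c>0 ε<¼ D H ∣H∣≡k o ∣∣H∣∣≡)

  Correct : DensestSubgraph → Tree → Set
  Correct D y = ∀ opt → DensestSubgraph.IsOptimum D opt → Σ (Subgraph (graph D)) λ H →
    y ≡ encodeSubgraph H × ∣ H ∣ᵥ ≡ k D ×
    opt ≤ 576 * c * c · n D ^[ scale (ℤ.+ 4 ℚ./ 1) ε ]· ∣∣ H ∣∣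

  correct : 0 < c → ε <ℚ (ℤ.+ 1 ℚ./ 4) → ∀ D → Correct D (encodeSubgraph (subgraph D))
  correct c>0 ε<¼ D opt isOpt = subgraph D , refl ,
    trans (count-tabulate (solution D)) (solution-card D) ,
    guaranteed c>0 ε<¼ D opt isOpt

open import Data.Integer.Base using (+_)
open import Data.Rational.Base using (_/_)

theorem4 : (ε : ℝ) → 0ℚ ℚ< ε → ε <ℚ (+ 1 / 4) →
    RankReductionApproximable ε →
    DensestSubgraphApproximable (scale (+ 4 / 1) ε)
theorem4 ε _ ε<¼ (c , c>0 , P , A , d , solve) =
  -- This is `4 * (12 * c) ^ 2`: the constant for the number of blocks, squared, and a 4 for the
  -- factor 2 in the number `n * (n + n)` of elements.
  576 * c * c , >-nonZero⁻¹ (576 * c * c) {{m*n≢0 (576 * c) c {{m*n≢0 576 c}}}} ,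
  polyTime {Correct = Correct} algorithm (correct c>0 ε<¼)
  where
  open Reduction ε c P A d solve
  instance
    c≢0 : NonZero c
    c≢0 = >-nonZero c>0
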